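{- If $\Gamma$ is a distance-regular graph with classical parameters $(D,b,\alpha,\beta)$ such that $b=2$ and $D\geq 12$, then $\alpha\leq 2$ and $\alpha\in\{0,\frac{1}{3},\frac{2}{3},1,\frac{4}{3},2\}$.
   Context: All graphs are finite, undirected and simple. A connected graph $\Gamma$ of diameter $D$ is distance-regular if for each $0\le i\le D$ there are integers $b_i,c_i$ such that for any two vertices $x,y$ at distance $i$, exactly $c_i$ neighbours of $y$ are at distance $i-1$ from $x$ and exactly $b_i$ neighbours of $y$ are at distance $i+1$ from $x$. Write $\left[\begin{smallmatrix} i\\ 1\end{smallmatrix}\right]_b=1+b+\dots+b^{i-1}$. A distance-regular graph of diameter $D$ has classical parameters $(D,b,\alpha,\beta)$ if for all $0\le i\le D$: $c_i=\left[\begin{smallmatrix} i\\ 1\end{smallmatrix}\right]_b\bigl(1+\alpha\left[\begin{smallmatrix} i-1\\ 1\end{smallmatrix}\right]_b\bigr)$ and $b_i=\bigl(\left[\begin{smallmatrix} D\\ 1\end{smallmatrix}\right]_b-\left[\begin{smallmatrix} i\\ 1\end{smallmatrix}\right]_b\bigr)\bigl(\beta-\alpha\left[\begin{smallmatrix} i\\ 1\end{smallmatrix}\right]_b\bigr)$. -}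

module Defs where

open import Data.Nat using (ℕ; zero; suc; _∸_; _≤_)
open import Data.Bool using (Bool; true; false; _∧_; _∨_; not)
open import Data.Fin using (Fin)
open import Data.Fin.Properties using (_≟_)
open import Data.List.Base using (List; length; filterᵇ; allFin)
open import Data.Bool.ListAction using (any)
open import Data.Product using (Σ; _×_; ∃-syntax)
open import Relation.Nullary.Decidable using (⌊_⌋)
open import Relation.Binary.PropositionalEquality using (_≡_)
open import Data.Integer using (+_)
open import Data.Rational using (ℚ; _+_; _*_; _-_; 0ℚ; 1ℚ) renaming (_/_ to _÷_)

record Graph : Set where
  field
    n       : ℕ
    adj     : Fin n → Fin n → Bool
    symm    : ∀ x y → adj x y ≡ adj y x
    irrefl  : ∀ x → adj x x ≡ false

module _ (Γ : Graph) where
  open Graph Γ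

  reach : Fin n → ℕ → Fin n → Bool
  reach x zero    y = ⌊ x ≟ y ⌋
  reach x (suc k) y = reach x k y ∨ any (λ z → reach x k z ∧ adj z y) (allFin n)

  distIs : Fin n → Fin n → ℕ → Bool
  distIs x y zero    = reach x zero y
  distIs x y (suc i) = reach x (suc i) y ∧ not (reach x i y)

  nbrsAt : Fin n → Fin n → ℕ → ℕ
  nbrsAt x y j = length (filterᵇ (λ z → adj y z ∧ distIs x z j) (allFin n))

  HasDiameter : ℕ → Set
  HasDiameter D = (∀ x y → reach x D y ≡ true)
                × (∃[ x ] ∃[ y ] distIs x y D ≡ true)

  -- Γ is distance-regular of diameter D with intersection numbers
  -- c i, b i (0 ≤ i ≤ D).  For i = 0, "distance i-1" is vacuous: there is
  -- no vertex at distance -1; the count uses distance 0 ∸ 1 = 0 but y = x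
  -- is not its own neighbour, so the count is 0 as required.
  IsDistanceRegular : ℕ → (ℕ → ℕ) → (ℕ → ℕ) → Set
  IsDistanceRegular D c b =
    HasDiameter D ×
    (∀ i → i ≤ D → ∀ x y → distIs x y i ≡ true →
       (nbrsAt x y (i ∸ 1) ≡ c i) × (nbrsAt x y (suc i) ≡ b i))

ℕtoℚ : ℕ → ℚ
ℕtoℚ k = (+ k) ÷ 1

[_]_ : ℕ → ℚ → ℚ
[ zero  ] b = 0ℚ
[ suc i ] b = 1ℚ + b * ([ i ] b)

HasClassicalParameters : Graph → ℕ → ℚ → ℚ → ℚ → Set
HasClassicalParameters Γ D b α β =
  Σ (ℕ → ℕ) λ c → Σ (ℕ → ℕ) λ bb →
    IsDistanceRegular Γ D c bb ×
    (∀ i → i ≤ D →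
       (ℕtoℚ (c i) ≡ ([ i ] b) * (1ℚ + α * ([ i ∸ 1 ] b))) ×
       (ℕtoℚ (bb i) ≡ (([ D ] b) - ([ i ] b)) * (β - α * ([ i ] b))))

{-# OPTIONS --safe #-}
module Submission where

-- Counting the vertices at distance j from x and m from y on the geodesics
-- between x and y shows that c_1⋯c_{j+m} / (c_1⋯c_j · c_1⋯c_m) is an integer
-- whenever j + m ≤ D.  With b = 2 and s = 3α = c_2 - 3 these numbers depend on
-- s alone: (j, m) = (2, 2) gives 3 + s ∣ 1260, and (j, j) for j = 3, …, 6 leaves
-- s ∈ {0, 1, 2, 3, 4, 6, 27}.  The value s = 27, that is α = 9, is killed by
-- (7, 7) if D ≥ 14.  For D = 12, 13 the eigenvalue θ₁ has an eigenfunction that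
-- is affine in 2^{D-d}, and its multiplicity, being the trace of a rational
-- idempotent matrix, is an integer.  In terms of W = 2^D this multiplicity is
-- (W - 1) β (W (β + 9) - 32) / ((9 W - 16) (β - 7)), so β - 7 divides a constant;
-- together with β > 9 (2^{D-1} - 1) only D = 12, β = 128968 survives, where the
-- number of vertices at distance 7 from a given vertex is not an integer.

open import Defs
open import Data.Nat using (ℕ; _≤_)
open import Data.Integer using (+_)
open import Data.Rational using (ℚ; 0ℚ; 1ℚ; _/_) renaming (_≤_ to _≤ℚ_)
open import Data.Sum using (_⊎_)
open import Data.Product using (_×_)
open import Relation.Binary.PropositionalEquality using (_≡_)

open import Algebra.Bundles using (CommutativeRing)
open import Data.Bool using (Bool; true; false; T; _∧_; not; if_then_else_)
open import Data.Bool.Properties using (T-≡; T-∧; T-∨; T?)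
open import Data.Empty using (⊥; ⊥-elim)
open import Data.Fin using (Fin; zero; suc; toℕ; fromℕ<)
open import Data.Fin.Properties using (toℕ<n; toℕ-injective; toℕ-fromℕ<; all?; ¬∀⟶∃¬)
import Data.Integer as ℤ
import Data.Integer.Properties as ℤ
open import Data.List.Base using (List; []; _∷_; length; filterᵇ; allFin; tabulate)
open import Data.List.Membership.Propositional using (lose)
open import Data.List.Membership.Propositional.Properties using (∈-allFin)
open import Data.List.Properties using (filter-some)
open import Data.List.Relation.Unary.Any using (here; there; satisfied)
open import Data.List.Relation.Unary.Any.Properties using (any⁺; any⁻)
open import Data.Nat as ℕ using (zero; suc; _∸_; _^_; _<_; _≡ᵇ_; _<ᵇ_; _≟_; _≤?_; _<?_; z≤n; s≤s; s≤s⁻¹;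
  _≤′_; ≤′-refl; ≤′-step; NonZero)
open import Data.List.Membership.DecPropositional _≟_ using (_∈_; _∈?_)
open import Data.Nat.Divisibility
import Data.Nat.Properties as ℕ
open import Data.Product using (_,_; ∃-syntax; proj₁; proj₂)
open import Data.Sum using (inj₁; inj₂)
open import Data.Unit using (tt)
open import Function using (_∘_; Equivalence)
open import Relation.Binary.Definitions using (tri<; tri≈; tri>)
open import Relation.Binary.PropositionalEquality hiding ([_])
open import Relation.Nullary using (¬_; Dec; yes; no)
open import Relation.Nullary.Decidable using (toWitness; fromWitness; toWitnessFalse; _→-dec_)

open Equivalence using (to; from)

-- The counting arguments share one source: the graph Laplacian is self-adjoint, and on functions of
-- the distance to a fixed vertex it acts through `Δ`, which involves only `c i` and `b i`. Pairing
-- two sphere indicators gives the recursion behind the geodesic quotients; pairing with the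
-- constant 1 gives the sphere sizes and the moments of `w` and `w²`; pairing with an eigenfunction
-- shows that every radial kernel acts on it as a scalar. A radial eigenfunction, used as a kernel
-- itself, is therefore idempotent up to a scalar, and the moments determine that scalar.
--
-- The `c i` do not contain β, so the geodesic quotients cannot constrain it, and the pair (7, 7) is
-- out of reach for `D = 12, 13`. The multiplicity brings β in, but its integrality is a
-- divisibility statement only once β is known to be a natural number. This follows from `b 0` and
-- `b (D - 1)` being integers, as their leading factors 2^D - 1 and 2^{D-1} are coprime.

¬T⇒false : ∀ {b} → ¬ T b → b ≡ false
¬T⇒false {false} _  = refl
¬T⇒false {true}  ¬t = ⊥-elim (¬t tt)

T⇒true : ∀ {b} → T b → b ≡ true
T⇒true = to T-≡

-- Graph distance as a bounded search over reachability

least : (ℕ → Bool) → ℕ → ℕ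
least p zero    = zero
least p (suc f) = if p 0 then 0 else suc (least (p ∘ suc) f)

least-≤ : (p : ℕ → Bool) (f k : ℕ) → T (p k) → least p f ≤ k
least-≤ p zero    k pk = z≤n
least-≤ p (suc f) k pk with p 0 in eq
least-≤ p (suc f) k       pk | true  = z≤n
least-≤ p (suc f) zero    pk | false = ⊥-elim (subst T eq pk)
least-≤ p (suc f) (suc k) pk | false = s≤s (least-≤ (p ∘ suc) f k pk)

-- The search returns its bound `f` by default, so `p f` alone guarantees success; for `dist` this
-- is connectedness within `D` steps.
least-sound : (p : ℕ → Bool) (f : ℕ) → T (p f) → T (p (least p f))
least-sound p zero    pf = pf
least-sound p (suc f) pf with p 0 in eq
... | true  = from T-≡ eq
... | false = least-sound (p ∘ suc) f pf

module Distance (Γ : Graph) where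
  open Graph Γ
  open import Data.Nat using (_+_)
  open import Data.Nat.Properties

  private
    variable
      x y z : Fin n
      j k   : ℕ

  -- A wrapper around the Boolean, so that the indices `x`, `k`, `y` can be inferred;
  -- `T (reach Γ x k y)` computes and would not determine them.
  record Reach (x : Fin n) (k : ℕ) (y : Fin n) : Set where
    constructor reached
    field holds : T (reach Γ x k y)

  Adj : Fin n → Fin n → Set
  Adj x y = T (adj x y)

  adj-sym : Adj x y → Adj y x
  adj-sym {x} {y} = subst T (symm x y)

  reach-refl : Reach x 0 x
  reach-refl = reached (fromWitness refl)

  reach-zero : Reach x 0 y → x ≡ y
  reach-zero (reached r) = toWitness r

  reach-suc : Reach x k y → Reach x (suc k) y
  reach-suc (reached r) = reached (from T-∨ (inj₁ r))

  reach-step : Reach x k z → Adj z y → Reach x (suc k) y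
  reach-step {x} {k} {z} {y} (reached r) a = reached
    (from (T-∨ {reach Γ x k y}) (inj₂ (any⁺ _ (lose (∈-allFin z) (from T-∧ (r , a))))))

  reach-last : Reach x (suc k) y → Reach x k y ⊎ ∃[ z ] (Reach x k z × Adj z y)
  reach-last {x} {k} {y} (reached r) with to (T-∨ {reach Γ x k y}) r
  ... | inj₁ r′ = inj₁ (reached r′)
  ... | inj₂ s with satisfied (any⁻ _ (allFin n) s)
  ...   | z , t with to (T-∧ {reach Γ x k z}) t
  ...     | r′ , a = inj₂ (z , reached r′ , a)

  reach-mono : j ≤ k → Reach x j y → Reach x k y
  reach-mono j≤k = go (≤⇒≤′ j≤k)
    where
    go : j ≤′ k → Reach x j y → Reach x k y
    go ≤′-refl     r = r
    go (≤′-step p) r = reach-suc (go p r)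

  reach-trans : Reach x j y → Reach y k z → Reach x (k + j) z
  reach-trans {k = zero}  r s = subst (Reach _ _) (reach-zero s) r
  reach-trans {k = suc k} r s with reach-last s
  ... | inj₁ s′           = reach-suc (reach-trans r s′)
  ... | inj₂ (_ , s′ , a) = reach-step (reach-trans r s′) a

  reach-sym : Reach x k y → Reach y k x
  reach-sym {k = zero}  r = subst (λ w → Reach w 0 _) (reach-zero r) reach-refl
  reach-sym {x} {suc k} {y} r with reach-last r
  ... | inj₁ r′           = reach-suc (reach-sym r′)
  ... | inj₂ (_ , r′ , a) = subst (λ m → Reach y m x) (+-comm k 1)
    (reach-trans (reach-step reach-refl (adj-sym a)) (reach-sym r′))

  module Bounded (D : ℕ) (connected : ∀ x y → reach Γ x D y ≡ true) where

    dist : Fin n → Fin n → ℕ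
    dist x y = least (λ k → reach Γ x k y) D

    reach⇒dist≤ : Reach x k y → dist x y ≤ k
    reach⇒dist≤ (reached r) = least-≤ _ D _ r

    dist-reach : ∀ x y → Reach x (dist x y) y
    dist-reach x y = reached (least-sound (λ k → reach Γ x k y) D (from T-≡ (connected x y)))

    dist≤⇒reach : dist x y ≤ k → Reach x k y
    dist≤⇒reach d≤k = reach-mono d≤k (dist-reach _ _)

    dist≤D : ∀ x y → dist x y ≤ D
    dist≤D x y = reach⇒dist≤ (reached (from T-≡ (connected x y)))

    dist-refl : ∀ x → dist x x ≡ 0
    dist-refl x = n≤0⇒n≡0 (reach⇒dist≤ reach-refl)

    dist-zero : dist x y ≡ 0 → x ≡ y
    dist-zero eq = reach-zero (dist≤⇒reach (≤-reflexive eq))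

    dist-sym : ∀ x y → dist x y ≡ dist y x
    dist-sym x y = ≤-antisym (half y x) (half x y)
      where
      half : ∀ x y → dist y x ≤ dist x y
      half x y = reach⇒dist≤ (reach-sym (dist-reach x y))

    dist-triangle : ∀ x y z → dist x z ≤ dist x y + dist y z
    dist-triangle x y z = subst (dist x z ≤_) (+-comm (dist y z) _)
      (reach⇒dist≤ (reach-trans (dist-reach x y) (dist-reach y z)))

    dist-adj : Adj y z → ∀ x → dist x z ≤ suc (dist x y)
    dist-adj a x = reach⇒dist≤ (reach-step (dist-reach x _) a)

    distIs⇒dist : ∀ x y k → T (distIs Γ x y k) → dist x y ≡ k
    distIs⇒dist x y zero    t = n≤0⇒n≡0 (reach⇒dist≤ (reached t))
    distIs⇒dist x y (suc k) t with to (T-∧ {reach Γ x (suc k) y}) t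
    ... | r , ¬r = ≤-antisym (reach⇒dist≤ (reached r)) (≰⇒> λ d≤k →
      subst T (trans (sym (T⇒true ¬r)) (cong not (T⇒true (Reach.holds (dist≤⇒reach d≤k))))) tt)

    dist⇒distIs : ∀ x y k → dist x y ≡ k → T (distIs Γ x y k)
    dist⇒distIs x y zero    eq = Reach.holds (dist≤⇒reach (≤-reflexive eq))
    dist⇒distIs x y (suc k) eq = from (T-∧ {reach Γ x (suc k) y})
      ( Reach.holds (dist≤⇒reach (≤-reflexive eq))
      , subst (T ∘ not) (sym (¬T⇒false λ r → 1+n≰n (subst (_≤ k) eq (reach⇒dist≤ (reached r))))) tt)

    predecessor : dist x y ≡ suc k → ∃[ z ] (dist x z ≡ k × Adj z y)
    predecessor {x} {y} {k} eq with reach-last (dist≤⇒reach (≤-reflexive eq))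
    ... | inj₁ r = ⊥-elim (1+n≰n (subst (_≤ k) eq (reach⇒dist≤ r)))
    ... | inj₂ (z , r , a) =
      z , ≤-antisym (reach⇒dist≤ r) (s≤s⁻¹ (subst (_≤ suc (dist x z)) eq (dist-adj a x))) , a

-- Divisibility conditions on 3α and finite searches

module Arithmetic where
  open import Data.Nat using (_+_; _*_)
  open import Data.Nat.DivMod using (m*n/n≡m)
  open import Data.Nat.Properties
  open import Data.Nat.Solver using (module +-*-Solver)

  factorial : (ℕ → ℕ) → ℕ → ℕ
  factorial f zero    = 1
  factorial f (suc k) = f k * factorial f k

  factorial-cong : ∀ {f g : ℕ → ℕ} k → (∀ i → i < k → f i ≡ g i) → factorial f k ≡ factorial g k
  factorial-cong zero    f≡g = refl
  factorial-cong (suc k) f≡g = cong₂ _*_ (f≡g k (n<1+n k)) (factorial-cong k (λ i i<k → f≡g i (m<n⇒m<1+n i<k)))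

  factorial-scale : ∀ f r k → factorial (λ i → r * f i) k ≡ r ^ k * factorial f k
  factorial-scale f r zero    = refl
  factorial-scale f r (suc k) = trans (cong (r * f k *_) (factorial-scale f r k)) ([m*n]*[o*p]≡[m*o]*[n*p] r (f k) (r ^ k) (factorial f k))

  bracketℕ : ℕ → ℕ
  bracketℕ zero    = 0
  bracketℕ (suc i) = 1 + 2 * bracketℕ i

  -- 3 c_{i+1} when 3 α = s.
  tripleC : ℕ → ℕ → ℕ
  tripleC s i = bracketℕ (suc i) * (3 + s * bracketℕ i)

  CentralDivides : ℕ → ℕ → Set
  CentralDivides s j = factorial (tripleC s) j * factorial (tripleC s) j ∣ factorial (tripleC s) (j + j)

  centralDivides? : ∀ s j → Dec (CentralDivides s j)
  centralDivides? s j = _ ∣? _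

  -- After cancelling `81 * (3 + s)` the condition says that `3 + s` divides
  -- `35 * (1 + s) * (3 + 7 * s)`. Modulo `3 + s` one has s = -3, and 35 · (-2) · (-18) = 1260. The
  -- summand `1120 * (3 + s)` keeps the computation free of subtraction.
  3+s∣1260 : ∀ s → CentralDivides s 2 → 3 + s ∣ 1260
  3+s∣1260 s (divides q eq) = ∣m+n∣m⇒∣n (divides (q + 1120) (begin
      245 * (3 + s) * (3 + s) + 1260
        ≡⟨ solve 1 (λ s → con 245 :* (con 3 :+ s) :* (con 3 :+ s) :+ con 1260 := con 35 :* (con 1 :+ s) :* (con 3 :+ con 7 :* s) :+ con 1120 :* (con 3 :+ s)) refl s ⟩
      35 * (1 + s) * (3 + 7 * s) + 1120 * (3 + s)   ≡⟨ cong (_+ 1120 * (3 + s)) reduced ⟩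
      q * (3 + s) + 1120 * (3 + s)                  ≡⟨ *-distribʳ-+ (3 + s) q 1120 ⟨
      (q + 1120) * (3 + s)                          ∎))
    (n∣m*n (245 * (3 + s)))
    where
    open ≡-Reasoning
    open +-*-Solver
    reduced : 35 * (1 + s) * (3 + 7 * s) ≡ q * (3 + s)
    reduced = *-cancelˡ-≡ _ _ (81 * (3 + s)) (begin
      81 * (3 + s) * (35 * (1 + s) * (3 + 7 * s))
        ≡⟨ solve 1 (λ s → con 81 :* (con 3 :+ s) :* (con 35 :* (con 1 :+ s) :* (con 3 :+ con 7 :* s))
             := con 15 :* (con 3 :+ s :* con 7) :* (con 7 :* (con 3 :+ s :* con 3) :* (con 3 :* (con 3 :+ s :* con 1) :* (con 1 :* (con 3 :+ s :* con 0) :* con 1)))) refl s ⟩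
      factorial (tripleC s) 4
        ≡⟨ eq ⟩
      q * (factorial (tripleC s) 2 * factorial (tripleC s) 2)
        ≡⟨ solve 2 (λ q s → q :* ((con 3 :* (con 3 :+ s :* con 1) :* (con 1 :* (con 3 :+ s :* con 0) :* con 1)) :* (con 3 :* (con 3 :+ s :* con 1) :* (con 1 :* (con 3 :+ s :* con 0) :* con 1)))
             := con 81 :* (con 3 :+ s) :* (q :* (con 3 :+ s))) refl q s ⟩
      81 * (3 + s) * (q * (3 + s)) ∎)

  -- 0, 1, 2, 3, 4, 6 are the values of 3 α in the theorem; 27 is α = 9.
  candidates : List ℕ
  candidates = 0 ∷ 1 ∷ 2 ∷ 3 ∷ 4 ∷ 6 ∷ 27 ∷ []

  opaque

    sieve : ∀ {s} → s < 1258 → CentralDivides s 3 → CentralDivides s 4 → CentralDivides s 5 → CentralDivides s 6 → s ∈ candidates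
    sieve = toWitness {a? = allUpTo? (λ s → centralDivides? s 3 →-dec centralDivides? s 4 →-dec centralDivides? s 5 →-dec centralDivides? s 6 →-dec (s ∈? candidates)) 1258} _

    ¬centralDivides-27-7 : ¬ CentralDivides 27 7
    ¬centralDivides-27-7 = toWitnessFalse {a? = centralDivides? 27 7} _

  -- The case `j = 2` is used only for the bound `3 + s ≤ 1260`, which makes the remaining
  -- conditions a finite check.
  survivors : ∀ s → (∀ j → j ≤ 6 → CentralDivides s j) → s ∈ candidates
  survivors s central = sieve s<1258 (central 3 (toWitness {a? = 3 ≤? 6} _)) (central 4 (toWitness {a? = 4 ≤? 6} _)) (central 5 (toWitness {a? = 5 ≤? 6} _)) (central 6 ≤-refl)
    where
    s<1258 : s < 1258
    s<1258 = +-cancelˡ-≤ 3 (suc s) 1258 (s≤s (∣⇒≤ (3+s∣1260 s (central 2 (toWitness {a? = 2 ≤? 6} _)))))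

  -- A divisor that is at least `lo` has a cofactor of at most `C / lo`, so a search over cofactors
  -- stays short although the divisor is unbounded a priori.
  codivisor : ∀ {d C} lo E → d ∣ C → C ≢ 0 → lo ≤ d → C < suc E * lo → ∃[ e ] e < E × C ≡ suc e * d
  codivisor lo E (divides zero    C≡0) C≢0 lo≤d C<  = ⊥-elim (C≢0 C≡0)
  codivisor lo E (divides (suc e) C≡)  C≢0 lo≤d C<  =
    e , ≤-pred (*-cancelʳ-< lo (suc e) (suc E) (≤-<-trans (*-monoʳ-≤ (suc e) lo≤d) (subst (_< suc E * lo) C≡ C<))) , C≡

  -- The integrality of the multiplicity for β = d + 7, with a factor 16 cancelled:
  -- K = (9 W - 16) / 16, M = W - 1, L = W / 16 and R = W - 2.
  record Equation (K M L R N d : ℕ) : Set where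
    constructor equation
    field holds : N * (K * d) ≡ M * (d + 7) * (L * d + R)

  module _ {K M L R N d : ℕ} (eq : Equation K M L R N d) where

    private
      holds = Equation.holds eq

    Kd∣ : K * d ∣ M * (d + 7) * (L * d + R)
    Kd∣ = divides N (sym holds)

    -- Modulo `d` the right-hand side of the equation is `M * 7 * R`, while the left-hand side
    -- vanishes.
    d∣7MR : d ∣ 7 * M * R
    d∣7MR = ∣m+n∣m⇒∣n (divides (N * K) (begin
      M * (L * d + R + 7 * L) * d + 7 * M * R
        ≡⟨ solve 4 (λ M L R d → M :* (L :* d :+ R :+ con 7 :* L) :* d :+ con 7 :* M :* R := M :* (d :+ con 7) :* (L :* d :+ R)) refl M L R d ⟩
      M * (d + 7) * (L * d + R) ≡⟨ holds ⟨
      N * (K * d)               ≡⟨ *-assoc N K d ⟨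
      N * K * d                 ∎)) (n∣m*n (M * (L * d + R + 7 * L)))
      where
      open ≡-Reasoning
      open +-*-Solver

  -- A solution d divides the constant 7 M R; d itself is large, so the search
  -- runs over the cofactor.
  CodivisorCheck : (K M L R : ℕ) → (ℕ → Set) → ℕ → Set
  CodivisorCheck K M L R P e = suc e ∣ 7 * M * R → K * d ∣ M * (d + 7) * (L * d + R) → P d
    where d = 7 * M * R ℕ./ suc e

  codivisorCheck? : ∀ K M L R {P : ℕ → Set} → (∀ d → Dec (P d)) → ∀ e → Dec (CodivisorCheck K M L R P e)
  codivisorCheck? K M L R P? e = _ ∣? _ →-dec _ ∣? _ →-dec P? _

  solution-satisfies : ∀ {K M L R N d} {P : ℕ → Set} lo E → (∀ {e} → e < E → CodivisorCheck K M L R P e) →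
              7 * M * R ≢ 0 → 7 * M * R < suc E * lo → Equation K M L R N d → lo ≤ d → P d
  solution-satisfies {K} {M} {L} {R} {N} {d} {P} lo E check C≢0 C< eq lo≤d = finish (codivisor lo E (d∣7MR eq) C≢0 lo≤d C<)
    where
    finish : ∃[ e ] e < E × 7 * M * R ≡ suc e * d → P d
    finish (e , e<E , C≡) = subst P C/e≡d (check e<E (divides d (trans C≡ (*-comm (suc e) d)))
        (subst (λ d → K * d ∣ M * (d + 7) * (L * d + R)) (sym C/e≡d) (Kd∣ eq)))
      where
      C/e≡d : 7 * M * R ℕ./ suc e ≡ d
      C/e≡d = trans (cong (ℕ._/ suc e) (trans C≡ (*-comm (suc e) d))) (m*n/n≡m d (suc e))

  opaque

    -- The constants are those of W = 4096. The bound 18417 comes from β > 9 · 2047 = 18423 and d =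
    -- β - 7; it leaves fewer than 6374 cofactors.
    solutions-12 : ∀ {N d} → Equation 2303 4095 256 4094 N d → 18417 ≤ d → d ≡ 128961
    solutions-12 = solution-satisfies {P = _≡ 128961} 18417 6373 (toWitness {a? = allUpTo? (codivisorCheck? 2303 4095 256 4094 (_≟ 128961)) 6373} _)
      (λ ()) (toWitness {a? = 7 * 4095 * 4094 <? 6374 * 18417} _)

    solutions-13 : ∀ {N d} → Equation 4607 8191 512 8190 N d → 36849 ≤ d → ⊥
    solutions-13 = solution-satisfies {P = λ _ → ⊥} 36849 12745 (toWitness {a? = allUpTo? (codivisorCheck? 4607 8191 512 8190 {P = λ _ → ⊥} (λ _ → no λ ())) 12745} _)
      (λ ()) (toWitness {a? = 7 * 8191 * 8190 <? 12746 * 36849} _)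

open import Data.Rational using (_+_; _*_; _-_; -_; ½; 1/_; ≢-nonZero; toℚᵘ; fromℚᵘ) renaming (_≤?_ to _≤ℚ?_)
import Data.Rational.Properties as ℚ
open import Data.Rational.Properties using (toℚᵘ-injective; toℚᵘ-fromℚᵘ; toℚᵘ-homo-+; toℚᵘ-homo-*;
  fromℚᵘ-injective; +-*-commutativeRing;
  +-identityˡ; +-identityʳ; *-identityˡ; *-identityʳ; *-zeroˡ; *-zeroʳ; *-comm; *-assoc; *-inverseʳ)
open import Data.Rational.Solver using (module +-*-Solver)
import Data.Rational.Unnormalised as ℚᵘ
import Data.Rational.Unnormalised.Properties as ℚᵘ
import Algebra.Properties.Semiring.Sum (CommutativeRing.semiring +-*-commutativeRing) as Sum
open import Data.Nat.Solver renaming (module +-*-Solver to S)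
open +-*-Solver
open Arithmetic

-- Transfer between ℕ and ℚ, and finite sums

ℕtoℚ-+ : ∀ m n → ℕtoℚ (m ℕ.+ n) ≡ ℕtoℚ m + ℕtoℚ n
ℕtoℚ-+ m n = toℚᵘ-injective (begin
  toℚᵘ (ℕtoℚ (m ℕ.+ n))                ≈⟨ toℚᵘ-fromℚᵘ _ ⟩
  ℚᵘ.mkℚᵘ (ℤ.+ (m ℕ.+ n)) 0              ≈⟨ ℚᵘ.*≡* (cong (ℤ._* ℤ.+ 1) (sym (cong₂ ℤ._+_ (ℤ.*-identityʳ (ℤ.+ m)) (ℤ.*-identityʳ (ℤ.+ n))))) ⟩
  ℚᵘ.mkℚᵘ (ℤ.+ m) 0 ℚᵘ.+ ℚᵘ.mkℚᵘ (ℤ.+ n) 0 ≈⟨ ℚᵘ.+-cong (toℚᵘ-fromℚᵘ (ℚᵘ.mkℚᵘ (ℤ.+ m) 0)) (toℚᵘ-fromℚᵘ (ℚᵘ.mkℚᵘ (ℤ.+ n) 0)) ⟨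
  toℚᵘ (ℕtoℚ m) ℚᵘ.+ toℚᵘ (ℕtoℚ n)     ≈⟨ toℚᵘ-homo-+ (ℕtoℚ m) (ℕtoℚ n) ⟨
  toℚᵘ (ℕtoℚ m + ℕtoℚ n)               ∎)
  where open ℚᵘ.≃-Reasoning

ℕtoℚ-* : ∀ m n → ℕtoℚ (m ℕ.* n) ≡ ℕtoℚ m * ℕtoℚ n
ℕtoℚ-* m n = toℚᵘ-injective (begin
  toℚᵘ (ℕtoℚ (m ℕ.* n))                ≈⟨ toℚᵘ-fromℚᵘ _ ⟩
  ℚᵘ.mkℚᵘ (ℤ.+ (m ℕ.* n)) 0              ≈⟨ ℚᵘ.*≡* (cong (ℤ._* ℤ.+ 1) (ℤ.pos-* m n)) ⟩
  ℚᵘ.mkℚᵘ (ℤ.+ m) 0 ℚᵘ.* ℚᵘ.mkℚᵘ (ℤ.+ n) 0 ≈⟨ ℚᵘ.*-cong (toℚᵘ-fromℚᵘ (ℚᵘ.mkℚᵘ (ℤ.+ m) 0)) (toℚᵘ-fromℚᵘ (ℚᵘ.mkℚᵘ (ℤ.+ n) 0)) ⟨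
  toℚᵘ (ℕtoℚ m) ℚᵘ.* toℚᵘ (ℕtoℚ n)     ≈⟨ toℚᵘ-homo-* (ℕtoℚ m) (ℕtoℚ n) ⟨
  toℚᵘ (ℕtoℚ m * ℕtoℚ n)               ∎)
  where open ℚᵘ.≃-Reasoning

ℕtoℚ-injective : ∀ {m n} → ℕtoℚ m ≡ ℕtoℚ n → m ≡ n
ℕtoℚ-injective {m} {n} eq with fromℚᵘ-injective {ℚᵘ.mkℚᵘ (ℤ.+ m) 0} {ℚᵘ.mkℚᵘ (ℤ.+ n) 0} eq
... | ℚᵘ.*≡* e = ℤ.+-injective (trans (sym (ℤ.*-identityʳ (ℤ.+ m))) (trans e (ℤ.*-identityʳ (ℤ.+ n))))

recip : ∀ {p} → p ≢ 0ℚ → ∃[ r ] p * r ≡ 1ℚ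
recip {p} p≢0 = let instance _ = ≢-nonZero p≢0 in 1/ p , *-inverseʳ p

*-cancelˡ-≢0 : ∀ {p q r} → p ≢ 0ℚ → p * q ≡ p * r → q ≡ r
*-cancelˡ-≢0 {p} {q} {r} p≢0 eq with recip p≢0
... | s , ps≡1 = begin
  q           ≡⟨ *-identityˡ q ⟨
  1ℚ * q      ≡⟨ cong (_* q) ps≡1 ⟨
  p * s * q   ≡⟨ solve 3 (λ p s q → p :* s :* q := s :* (p :* q)) refl p s q ⟩
  s * (p * q) ≡⟨ cong (s *_) eq ⟩
  s * (p * r) ≡⟨ solve 3 (λ p s q → s :* (p :* q) := p :* s :* q) refl p s r ⟩
  p * s * r   ≡⟨ cong (_* r) ps≡1 ⟩
  1ℚ * r      ≡⟨ *-identityˡ r ⟩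
  r           ∎
  where open ≡-Reasoning

*-≢0 : ∀ {p q} → p ≢ 0ℚ → q ≢ 0ℚ → p * q ≢ 0ℚ
*-≢0 {p} p≢0 q≢0 pq≡0 = q≢0 (*-cancelˡ-≢0 p≢0 (trans pq≡0 (sym (*-zeroʳ p))))

opaque

  ∑ : ∀ {n} → (Fin n → ℚ) → ℚ
  ∑ = Sum.sum

  ∑-empty : (f : Fin 0 → ℚ) → ∑ f ≡ 0ℚ
  ∑-empty f = refl

  ∑-suc : ∀ {n} (f : Fin (suc n) → ℚ) → ∑ f ≡ f zero + ∑ (λ i → f (suc i))
  ∑-suc f = refl

  ∑-cong : ∀ {n} {f g : Fin n → ℚ} → (∀ i → f i ≡ g i) → ∑ f ≡ ∑ g
  ∑-cong = Sum.sum-cong-≗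

  ∑-+ : ∀ {n} (f g : Fin n → ℚ) → ∑ (λ i → f i + g i) ≡ ∑ f + ∑ g
  ∑-+ = Sum.∑-distrib-+

  ∑-*ˡ : ∀ {n} s (f : Fin n → ℚ) → ∑ (λ i → s * f i) ≡ s * ∑ f
  ∑-*ˡ s f = sym (Sum.*-distribˡ-sum s f)

  ∑-swap : ∀ {m n} (f : Fin m → Fin n → ℚ) → ∑ (λ i → ∑ (f i)) ≡ ∑ (λ j → ∑ (λ i → f i j))
  ∑-swap = Sum.∑-comm

∑-zero : ∀ {n} {f : Fin n → ℚ} → (∀ i → f i ≡ 0ℚ) → ∑ f ≡ 0ℚ
∑-zero {zero}  {f} _   = ∑-empty f
∑-zero {suc n} {f} f≡0 = trans (∑-suc f) (cong₂ _+_ (f≡0 zero) (∑-zero (λ i → f≡0 (suc i))))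

∑-+-* : ∀ {n} s (f g : Fin n → ℚ) → ∑ (λ i → f i + s * g i) ≡ ∑ f + s * ∑ g
∑-+-* s f g = trans (∑-+ f _) (cong (λ t → ∑ f + t) (∑-*ˡ s g))

-- Idempotent rational matrices

Matrix : ℕ → Set
Matrix n = Fin n → Fin n → ℚ

trace : ∀ {n} → Matrix n → ℚ
trace E = ∑ (λ i → E i i)

Idempotent : ∀ {n} → Matrix n → Set
Idempotent E = ∀ a b → ∑ (λ k → E a k * E k b) ≡ E a b

-- Wedderburn rank reduction: with `s` the inverse of the pivot `E i j`, the product of column `j`
-- and row `i`, scaled by `s`, is subtracted. Idempotency of `E` collapses every product of rows and
-- columns that arises, and gives the subtracted piece the trace `s * E i j`, which is 1.
module Deflate {n} (E : Matrix n) (idem : Idempotent E) (i j : Fin n) (s : ℚ) (inv : E i j * s ≡ 1ℚ) where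

  deflated : Matrix n
  deflated a b = E a b + - s * (E a j * E i b)

  deflated-idem : Idempotent deflated
  deflated-idem a b = begin
    ∑ (λ k → deflated a k * deflated k b)
      ≡⟨ ∑-cong (λ k → solve 7 (λ s x y z u v w → (x :+ :- s :* (y :* z)) :* (u :+ :- s :* (v :* w)) :=
           x :* u :+ :- (s :* y) :* (z :* u) :+ :- (s :* w) :* (x :* v) :+ s :* s :* (y :* w) :* (z :* v))
           refl s (E a k) (E a j) (E i k) (E k b) (E k j) (E i b)) ⟩
    ∑ (λ k → E a k * E k b + - (s * E a j) * (E i k * E k b) + - (s * E i b) * (E a k * E k j) + s * s * (E a j * E i b) * (E i k * E k j))
      ≡⟨ trans (∑-+-* (s * s * (E a j * E i b)) _ _) (cong (_+ s * s * (E a j * E i b) * ∑ (λ k → E i k * E k j)) (trans (∑-+-* (- (s * E i b)) _ _) (cong (_+ - (s * E i b) * ∑ (λ k → E a k * E k j)) (∑-+-* (- (s * E a j)) _ _)))) ⟩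
    _ ≡⟨ cong₂ _+_ (cong₂ _+_ (cong₂ _+_ (idem a b) (cong (- (s * E a j) *_) (idem i b))) (cong (- (s * E i b) *_) (idem a j))) (cong (s * s * (E a j * E i b) *_) (idem i j)) ⟩
    E a b + - (s * E a j) * E i b + - (s * E i b) * E a j + s * s * (E a j * E i b) * E i j
      ≡⟨ solve 5 (λ s p x y z → x :+ :- (s :* y) :* z :+ :- (s :* z) :* y :+ s :* s :* (y :* z) :* p :=
           x :+ (s :* (p :* s) :+ :- s :+ :- s) :* (y :* z)) refl s (E i j) (E a b) (E a j) (E i b) ⟩
    E a b + (s * (E i j * s) + - s + - s) * (E a j * E i b)
      ≡⟨ cong (λ t → E a b + (s * t + - s + - s) * (E a j * E i b)) inv ⟩
    E a b + (s * 1ℚ + - s + - s) * (E a j * E i b)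
      ≡⟨ solve 3 (λ s x y → x :+ (s :* con 1ℚ :+ :- s :+ :- s) :* y := x :+ :- s :* y) refl s (E a b) (E a j * E i b) ⟩
    deflated a b ∎
    where open ≡-Reasoning

  deflated-row : ∀ b → deflated i b ≡ 0ℚ
  deflated-row b = begin
    E i b + - s * (E i j * E i b)  ≡⟨ solve 3 (λ s p x → x :+ :- s :* (p :* x) := (con 1ℚ :- p :* s) :* x) refl s (E i j) (E i b) ⟩
    (1ℚ - E i j * s) * E i b       ≡⟨ cong (λ t → (1ℚ - t) * E i b) inv ⟩
    0ℚ * E i b                     ≡⟨ *-zeroˡ (E i b) ⟩
    0ℚ                             ∎
    where open ≡-Reasoning

  -- Rows cleared earlier stay cleared, so the reduction can proceed row by row.
  deflated-zero : ∀ a → (∀ b → E a b ≡ 0ℚ) → ∀ b → deflated a b ≡ 0ℚ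
  deflated-zero a row b = begin
    E a b + - s * (E a j * E i b) ≡⟨ cong₂ (λ x y → x + - s * (y * E i b)) (row b) (row j) ⟩
    0ℚ + - s * (0ℚ * E i b)       ≡⟨ solve 2 (λ s x → con 0ℚ :+ :- s :* (con 0ℚ :* x) := con 0ℚ) refl s (E i b) ⟩
    0ℚ                            ∎
    where open ≡-Reasoning

  trace-deflated : trace E ≡ 1ℚ + trace deflated
  trace-deflated = sym (begin
    1ℚ + trace deflated ≡⟨ cong (λ t → 1ℚ + t) (trans (∑-+-* (- s) (λ k → E k k) (λ k → E k j * E i k))
                             (cong (λ t → trace E + - s * t) (trans (∑-cong (λ k → *-comm (E k j) (E i k))) (idem i j)))) ⟩
    1ℚ + (trace E + - s * E i j) ≡⟨ solve 3 (λ t s p → con 1ℚ :+ (t :+ :- s :* p) := t :+ (con 1ℚ :- p :* s)) refl (trace E) s (E i j) ⟩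
    trace E + (1ℚ - E i j * s) ≡⟨ cong (λ t → trace E + (1ℚ - t)) inv ⟩
    trace E + 0ℚ ≡⟨ +-identityʳ (trace E) ⟩
    trace E ∎)
    where open ≡-Reasoning

-- The trace of an idempotent is its rank: subtracting a rank one piece that
-- clears a nonzero row keeps the matrix idempotent and lowers the trace by 1.
trace-idempotent : ∀ {n} (E : Matrix n) → Idempotent E → ∃[ N ] trace E ≡ ℕtoℚ N
trace-idempotent {n} E idem = go n E idem (λ i b n≤i → ⊥-elim (ℕ.<⇒≱ (toℕ<n i) n≤i))
  where
  -- Invariant: all rows of index at least `r` are zero. The count `r` starts at `n`, where this is
  -- vacuous, and goes down.
  go : ∀ r (E : Matrix n) → Idempotent E → (∀ i b → r ≤ toℕ i → E i b ≡ 0ℚ) → ∃[ N ] trace E ≡ ℕtoℚ N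
  go zero    E idem rows = 0 , ∑-zero (λ i → rows i i ℕ.z≤n)
  go (suc r) E idem rows with r ℕ.<? n
  ... | no r≮n = go r E idem (λ i b r≤i → ⊥-elim (r≮n (ℕ.≤-<-trans r≤i (toℕ<n i))))
  ... | yes r<n with all? (λ b → E (fromℕ< r<n) b ℚ.≟ 0ℚ)
  ...   | yes row = go r E idem below
    where
    below : ∀ i b → r ≤ toℕ i → E i b ≡ 0ℚ
    below i b r≤i with r ℕ.≟ toℕ i
    ... | yes r≡i = subst (λ k → E k b ≡ 0ℚ) (toℕ-injective (trans (toℕ-fromℕ< r<n) r≡i)) (row b)
    ... | no r≢i  = rows i b (ℕ.≤∧≢⇒< r≤i r≢i)
  ...   | no ¬row with ¬∀⟶∃¬ n _ (λ b → E (fromℕ< r<n) b ℚ.≟ 0ℚ) ¬row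
  ...     | j , Eij≢0 with recip Eij≢0
  ...       | s , inv = finish (go r deflated deflated-idem below)
    where
    open Deflate E idem (fromℕ< r<n) j s inv
    below : ∀ i b → r ≤ toℕ i → deflated i b ≡ 0ℚ
    below i b r≤i with r ℕ.≟ toℕ i
    ... | yes r≡i = subst (λ k → deflated k b ≡ 0ℚ) (toℕ-injective (trans (toℕ-fromℕ< r<n) r≡i)) (deflated-row b)
    ... | no r≢i  = deflated-zero i (λ b → rows i b (ℕ.≤∧≢⇒< r≤i r≢i)) b
    finish : ∃[ N ] trace deflated ≡ ℕtoℚ N → ∃[ N ] trace E ≡ ℕtoℚ N
    finish (N , eq) = suc N , trans trace-deflated (trans (cong (λ t → 1ℚ + t) eq) (sym (ℕtoℚ-+ 1 N)))

-- Integrality of β and the multiplicity equation over ℕ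

ℕtoℚ-≢0 : ∀ {m} → 0 < m → ℕtoℚ m ≢ 0ℚ
ℕtoℚ-≢0 0<m eq = ℕ.<⇒≢ 0<m (sym (ℕtoℚ-injective eq))

∑-1 : ∀ n → ∑ {n} (λ _ → 1ℚ) ≡ ℕtoℚ n
∑-1 zero    = ∑-empty (λ _ → 1ℚ)
∑-1 (suc n) = trans (∑-suc {n} (λ _ → 1ℚ)) (trans (cong (λ t → 1ℚ + t) (∑-1 n)) (sym (ℕtoℚ-+ 1 n)))

ℕtoℚ-bracketℕ : ∀ i → ℕtoℚ (bracketℕ i) ≡ [ i ] ℕtoℚ 2
ℕtoℚ-bracketℕ zero    = refl
ℕtoℚ-bracketℕ (suc i) = trans (ℕtoℚ-+ 1 (2 ℕ.* bracketℕ i))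
  (cong (λ t → 1ℚ + t) (trans (ℕtoℚ-* 2 (bracketℕ i)) (cong (ℕtoℚ 2 *_) (ℕtoℚ-bracketℕ i))))

-- Since M = 2 H - 1 is coprime to H, the fraction β - A lies in both
-- ℤ / H and ℤ / M, hence in ℤ.
β-natural : ∀ M H A {b₀ b₁} (β : ℚ) → .{{_ : NonZero H}} → 2 ℕ.* H ≡ suc M → ℕtoℚ b₀ ≡ ℕtoℚ M * β →
            ℕtoℚ b₁ ≡ ℕtoℚ H * (β - ℕtoℚ A) → 0 < b₁ → ∃[ g ] β ≡ ℕtoℚ (suc g ℕ.+ A)
β-natural M H@(suc _) A {b₀} {b₁} β 2H≡1+M b₀≡ b₁≡ 0<b₁ = finish H∣b₁
  where
  open ≡-Reasoning
  balance : M ℕ.* b₁ ℕ.+ M ℕ.* A ℕ.* H ≡ b₀ ℕ.* H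
  balance = ℕtoℚ-injective (begin
    ℕtoℚ (M ℕ.* b₁ ℕ.+ M ℕ.* A ℕ.* H) ≡⟨ trans (ℕtoℚ-+ (M ℕ.* b₁) (M ℕ.* A ℕ.* H)) (cong₂ _+_ (ℕtoℚ-* M b₁) (trans (ℕtoℚ-* (M ℕ.* A) H) (cong (_* ℕtoℚ H) (ℕtoℚ-* M A)))) ⟩
    ℕtoℚ M * ℕtoℚ b₁ + ℕtoℚ M * ℕtoℚ A * ℕtoℚ H ≡⟨ cong (λ t → ℕtoℚ M * t + ℕtoℚ M * ℕtoℚ A * ℕtoℚ H) b₁≡ ⟩
    ℕtoℚ M * (ℕtoℚ H * (β - ℕtoℚ A)) + ℕtoℚ M * ℕtoℚ A * ℕtoℚ H
      ≡⟨ solve 4 (λ M H A β → M :* (H :* (β :- A)) :+ M :* A :* H := M :* β :* H) refl (ℕtoℚ M) (ℕtoℚ H) (ℕtoℚ A) β ⟩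
    ℕtoℚ M * β * ℕtoℚ H ≡⟨ cong (_* ℕtoℚ H) b₀≡ ⟨
    ℕtoℚ b₀ * ℕtoℚ H ≡⟨ ℕtoℚ-* b₀ H ⟨
    ℕtoℚ (b₀ ℕ.* H) ∎)
  H∣Mb₁ : H ∣ M ℕ.* b₁
  H∣Mb₁ = ∣m+n∣m⇒∣n (subst (H ∣_) (trans (sym balance) (ℕ.+-comm (M ℕ.* b₁) (M ℕ.* A ℕ.* H))) (n∣m*n b₀)) (n∣m*n (M ℕ.* A))
  -- `H` divides `2 * H * b₁`, which is `b₁ + M * b₁`.
  H∣b₁ : H ∣ b₁
  H∣b₁ = ∣m+n∣m⇒∣n (subst (H ∣_) (trans (cong (ℕ._* b₁) 2H≡1+M) (ℕ.+-comm b₁ (M ℕ.* b₁))) (∣-trans (n∣m*n 2) (m∣m*n b₁))) H∣Mb₁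
  finish : H ∣ b₁ → ∃[ g ] β ≡ ℕtoℚ (suc g ℕ.+ A)
  -- Positivity of `b₁` excludes β = A; hence the strict bound hidden in `suc g`.
  finish (divides zero    b₁≡0) = ⊥-elim (ℕ.<⇒≢ 0<b₁ (sym b₁≡0))
  finish (divides (suc g) b₁≡gH) = g , (begin
    β                             ≡⟨ solve 2 (λ β A → β := (β :- A) :+ A) refl β (ℕtoℚ A) ⟩
    (β - ℕtoℚ A) + ℕtoℚ A     ≡⟨ cong (_+ ℕtoℚ A) (*-cancelˡ-≢0 (ℕtoℚ-≢0 {H} (s≤s z≤n)) (begin
      ℕtoℚ H * (β - ℕtoℚ A)     ≡⟨ b₁≡ ⟨
      ℕtoℚ b₁                       ≡⟨ cong ℕtoℚ (trans b₁≡gH (ℕ.*-comm (suc g) H)) ⟩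
      ℕtoℚ (H ℕ.* suc g)              ≡⟨ ℕtoℚ-* H (suc g) ⟩
      ℕtoℚ H * ℕtoℚ (suc g)       ∎)) ⟩
    ℕtoℚ (suc g) + ℕtoℚ A       ≡⟨ ℕtoℚ-+ (suc g) A ⟨
    ℕtoℚ (suc g ℕ.+ A)              ∎)

-- With β = d + 7 the last factor is W (d + 16) - 32 = W d + (16 W - 32), so both sides carry
-- exactly the factor 16 that is cancelled.
multiplicity⇒Equation : ∀ K M L R {N d β W} → ℕtoℚ 9 * W - ℕtoℚ 16 ≡ ℕtoℚ 16 * ℕtoℚ K → W - 1ℚ ≡ ℕtoℚ M →
  W ≡ ℕtoℚ 16 * ℕtoℚ L → W * ℕtoℚ 16 - ℕtoℚ 32 ≡ ℕtoℚ 16 * ℕtoℚ R → β ≡ ℕtoℚ (d ℕ.+ 7) →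
  ℕtoℚ N * ((ℕtoℚ 9 * W - ℕtoℚ 16) * (β - ℕtoℚ 7)) ≡ (W - 1ℚ) * β * (W * (β + ℕtoℚ 9) - ℕtoℚ 32) →
  Equation K M L R N d
multiplicity⇒Equation K M L R {N} {d} {β} {W} hK hM hL hR hβ eq = equation (ℕtoℚ-injective (*-cancelˡ-≢0 {ℕtoℚ 16} (λ ()) (begin
  ℕtoℚ 16 * ℕtoℚ (N ℕ.* (K ℕ.* d))
    ≡⟨ cong (ℕtoℚ 16 *_) (trans (ℕtoℚ-* N (K ℕ.* d)) (cong (ℕtoℚ N *_) (ℕtoℚ-* K d))) ⟩
  ℕtoℚ 16 * (ℕtoℚ N * (ℕtoℚ K * ℕtoℚ d))
    ≡⟨ solve 3 (λ N K d → con (ℕtoℚ 16) :* (N :* (K :* d)) := N :* ((con (ℕtoℚ 16) :* K) :* (d :+ con (ℕtoℚ 7) :- con (ℕtoℚ 7)))) refl (ℕtoℚ N) (ℕtoℚ K) (ℕtoℚ d) ⟩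
  ℕtoℚ N * ((ℕtoℚ 16 * ℕtoℚ K) * (ℕtoℚ d + ℕtoℚ 7 - ℕtoℚ 7))
    ≡⟨ cong₂ (λ s t → ℕtoℚ N * (s * (t - ℕtoℚ 7))) hK β≡ ⟨
  ℕtoℚ N * ((ℕtoℚ 9 * W - ℕtoℚ 16) * (β - ℕtoℚ 7)) ≡⟨ eq ⟩
  (W - 1ℚ) * β * (W * (β + ℕtoℚ 9) - ℕtoℚ 32)
    ≡⟨ cong₂ (λ s t → s * t * (W * (t + ℕtoℚ 9) - ℕtoℚ 32)) hM β≡ ⟩
  ℕtoℚ M * (ℕtoℚ d + ℕtoℚ 7) * (W * (ℕtoℚ d + ℕtoℚ 7 + ℕtoℚ 9) - ℕtoℚ 32)
    ≡⟨ solve 3 (λ M d W → M :* (d :+ con (ℕtoℚ 7)) :* (W :* (d :+ con (ℕtoℚ 7) :+ con (ℕtoℚ 9)) :- con (ℕtoℚ 32))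
         := M :* (d :+ con (ℕtoℚ 7)) :* (W :* d :+ (W :* con (ℕtoℚ 16) :- con (ℕtoℚ 32)))) refl (ℕtoℚ M) (ℕtoℚ d) W ⟩
  ℕtoℚ M * (ℕtoℚ d + ℕtoℚ 7) * (W * ℕtoℚ d + (W * ℕtoℚ 16 - ℕtoℚ 32))
    ≡⟨ cong₂ (λ s t → ℕtoℚ M * (ℕtoℚ d + ℕtoℚ 7) * (s * ℕtoℚ d + t)) hL hR ⟩
  ℕtoℚ M * (ℕtoℚ d + ℕtoℚ 7) * (ℕtoℚ 16 * ℕtoℚ L * ℕtoℚ d + ℕtoℚ 16 * ℕtoℚ R)
    ≡⟨ solve 4 (λ M d L R → M :* (d :+ con (ℕtoℚ 7)) :* (con (ℕtoℚ 16) :* L :* d :+ con (ℕtoℚ 16) :* R)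
         := con (ℕtoℚ 16) :* (M :* (d :+ con (ℕtoℚ 7)) :* (L :* d :+ R))) refl (ℕtoℚ M) (ℕtoℚ d) (ℕtoℚ L) (ℕtoℚ R) ⟩
  ℕtoℚ 16 * (ℕtoℚ M * (ℕtoℚ d + ℕtoℚ 7) * (ℕtoℚ L * ℕtoℚ d + ℕtoℚ R))
    ≡⟨ cong (ℕtoℚ 16 *_) (trans (ℕtoℚ-* (M ℕ.* (d ℕ.+ 7)) (L ℕ.* d ℕ.+ R)) (cong₂ _*_
         (trans (ℕtoℚ-* M (d ℕ.+ 7)) (cong (ℕtoℚ M *_) (ℕtoℚ-+ d 7)))
         (trans (ℕtoℚ-+ (L ℕ.* d) R) (cong (_+ ℕtoℚ R) (ℕtoℚ-* L d))))) ⟨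
  ℕtoℚ 16 * ℕtoℚ (M ℕ.* (d ℕ.+ 7) ℕ.* (L ℕ.* d ℕ.+ R)) ∎)))
  where
  open ≡-Reasoning
  β≡ : β ≡ ℕtoℚ d + ℕtoℚ 7
  β≡ = trans hβ (ℕtoℚ-+ d 7)

-- Indicator functions and counting

𝟙 : Bool → ℚ
𝟙 true  = 1ℚ
𝟙 false = 0ℚ

𝟙-∧ : ∀ a b → 𝟙 (a ∧ b) ≡ 𝟙 a * 𝟙 b
𝟙-∧ true  true  = refl
𝟙-∧ true  false = refl
𝟙-∧ false true  = refl
𝟙-∧ false false = refl

𝟙-yes : ∀ {a} → T a → 𝟙 a ≡ 1ℚ
𝟙-yes {true} _ = refl

𝟙-no : ∀ {a} → ¬ T a → 𝟙 a ≡ 0ℚ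
𝟙-no {true}  ¬t = ⊥-elim (¬t tt)
𝟙-no {false} _  = refl

δ : ℕ → ℕ → ℚ
δ i j = 𝟙 (i ≡ᵇ j)

δ-refl : ∀ i → δ i i ≡ 1ℚ
δ-refl i = 𝟙-yes (ℕ.≡⇒≡ᵇ i i refl)

δ-≢ : ∀ {i j} → i ≢ j → δ i j ≡ 0ℚ
δ-≢ {i} {j} i≢j = 𝟙-no (i≢j ∘ ℕ.≡ᵇ⇒≡ i j)

ℕtoℚ-count : ∀ {n} (p : Fin n → Bool) → ℕtoℚ (length (filterᵇ p (allFin n))) ≡ ∑ (𝟙 ∘ p)
ℕtoℚ-count p = go p (λ i → i)
  where
  -- `allFin n` is `tabulate` of the identity; the induction on `n` needs an arbitrary tabulated
  -- function.
  go : ∀ {n} {A : Set} (p : A → Bool) (f : Fin n → A) → ℕtoℚ (length (filterᵇ p (tabulate f))) ≡ ∑ (𝟙 ∘ p ∘ f)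
  go {zero}  p f = sym (∑-empty (𝟙 ∘ p ∘ f))
  go {suc n} p f with p (f zero) in eq
  ... | true  = begin
    ℕtoℚ (suc (length (filterᵇ p (tabulate (f ∘ suc))))) ≡⟨ ℕtoℚ-+ 1 (length (filterᵇ p (tabulate (f ∘ suc)))) ⟩
    1ℚ + ℕtoℚ (length (filterᵇ p (tabulate (f ∘ suc))))  ≡⟨ cong₂ _+_ (cong 𝟙 (sym eq)) (go p (f ∘ suc)) ⟩
    𝟙 (p (f zero)) + ∑ (𝟙 ∘ p ∘ f ∘ suc)                 ≡⟨ ∑-suc (𝟙 ∘ p ∘ f) ⟨
    ∑ (𝟙 ∘ p ∘ f)                                        ∎
    where open ≡-Reasoning
  ... | false = begin
    ℕtoℚ (length (filterᵇ p (tabulate (f ∘ suc))))       ≡⟨ go p (f ∘ suc) ⟩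
    ∑ (𝟙 ∘ p ∘ f ∘ suc)                                  ≡⟨ +-identityˡ _ ⟨
    0ℚ + ∑ (𝟙 ∘ p ∘ f ∘ suc)                             ≡⟨ cong (_+ ∑ (𝟙 ∘ p ∘ f ∘ suc)) (cong 𝟙 (sym eq)) ⟩
    𝟙 (p (f zero)) + ∑ (𝟙 ∘ p ∘ f ∘ suc)                 ≡⟨ ∑-suc (𝟙 ∘ p ∘ f) ⟨
    ∑ (𝟙 ∘ p ∘ f)                                        ∎
    where open ≡-Reasoning

∑-δ : ∀ {n} (f : Fin n → ℚ) (x : Fin n) (e : Fin n → ℚ) → e x ≡ 1ℚ → (∀ z → z ≢ x → e z ≡ 0ℚ) →
      ∑ (λ z → e z * f z) ≡ f x
∑-δ f zero e ex≡1 e≡0 = begin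
  ∑ (λ z → e z * f z)                                ≡⟨ ∑-suc _ ⟩
  e zero * f zero + ∑ (λ z → e (suc z) * f (suc z))  ≡⟨ cong₂ _+_ (cong (_* f zero) ex≡1)
    (∑-zero (λ z → trans (cong (_* f (suc z)) (e≡0 (suc z) λ ())) (*-zeroˡ (f (suc z))))) ⟩
  1ℚ * f zero + 0ℚ                                   ≡⟨ trans (+-identityʳ _) (*-identityˡ _) ⟩
  f zero                                             ∎
  where open ≡-Reasoning
∑-δ f (suc x) e ex≡1 e≡0 = begin
  ∑ (λ z → e z * f z)                                ≡⟨ ∑-suc _ ⟩
  e zero * f zero + ∑ (λ z → e (suc z) * f (suc z))  ≡⟨ cong₂ _+_ (trans (cong (_* f zero) (e≡0 zero λ ())) (*-zeroˡ (f zero)))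
    (∑-δ (f ∘ suc) x (e ∘ suc) ex≡1 (λ z z≢x → e≡0 (suc z) λ { refl → z≢x refl })) ⟩
  0ℚ + f (suc x)                                     ≡⟨ +-identityˡ _ ⟩
  f (suc x)                                          ∎
  where open ≡-Reasoning

-- The Laplacian of a distance-regular graph

module DistanceRegular
  (Γ : Graph) (D : ℕ) (c b : ℕ → ℕ) (drg : IsDistanceRegular Γ D c b)
  where

  open Graph Γ

  private
    connected : ∀ x y → reach Γ x D y ≡ true
    connected = proj₁ (proj₁ drg)

  x₀ : Fin n
  x₀ = proj₁ (proj₂ (proj₁ drg))

  private
    y₀ : Fin n
    y₀ = proj₁ (proj₂ (proj₂ (proj₁ drg)))

    far : distIs Γ x₀ y₀ D ≡ true
    far = proj₂ (proj₂ (proj₂ (proj₁ drg)))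

    regular : ∀ i → i ≤ D → ∀ x y → distIs Γ x y i ≡ true →
      (nbrsAt Γ x y (i ∸ 1) ≡ c i) × (nbrsAt Γ x y (suc i) ≡ b i)
    regular = proj₂ drg

  open Distance Γ
  open Bounded D connected public

  A : Matrix n
  A y z = 𝟙 (adj y z)

  nbrs-sum : ∀ x y j → ℕtoℚ (nbrsAt Γ x y j) ≡ ∑ (λ z → A y z * δ j (dist x z))
  nbrs-sum x y j = trans (ℕtoℚ-count _) (∑-cong λ z → trans (𝟙-∧ (adj y z) _) (cong (A y z *_) (at z)))
    where
    at : ∀ z → 𝟙 (distIs Γ x z j) ≡ δ j (dist x z)
    at z with j ℕ.≟ dist x z
    ... | yes refl = trans (𝟙-yes (dist⇒distIs x z _ refl)) (sym (δ-refl (dist x z)))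
    ... | no  j≢d  = trans (𝟙-no λ t → j≢d (sym (distIs⇒dist x z j t))) (sym (δ-≢ j≢d))

  regular-at : ∀ x y → (nbrsAt Γ x y (dist x y ∸ 1) ≡ c (dist x y)) × (nbrsAt Γ x y (suc (dist x y)) ≡ b (dist x y))
  regular-at x y = regular (dist x y) (dist≤D x y) x y (T⇒true (dist⇒distIs x y _ refl))

  laplace : (Fin n → ℚ) → Fin n → ℚ
  laplace g y = ∑ (λ z → A y z * (g z - g y))

  -- The radial part of the Laplacian. Because it uses differences, neighbours at the same distance
  -- contribute nothing and no third intersection number appears. At `i = 0` truncation gives
  -- `i ∸ 1 = 0`, and the first term vanishes.
  Δ : (ℕ → ℚ) → ℕ → ℚ
  Δ φ i = (φ (i ∸ 1) - φ i) * ℕtoℚ (c i) + (φ (suc i) - φ i) * ℕtoℚ (b i)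

  private
    -- Along an edge the distance changes by at most one. When `i = d = 0` the first indicator is 1,
    -- but its coefficient `φ 0 - φ 0` is zero.
    step : ∀ (φ : ℕ → ℚ) i d → d ≤ suc i → i ≤ suc d →
           φ d - φ i ≡ (φ (i ∸ 1) - φ i) * δ (i ∸ 1) d + (φ (suc i) - φ i) * δ (suc i) d
    step φ i d d≤1+i i≤1+d with ℕ.<-cmp d i
    step φ (suc i) d d≤1+i i≤1+d | tri< d<i _ _ with ℕ.≤-antisym (s≤s⁻¹ d<i) (s≤s⁻¹ i≤1+d)
    ... | refl = begin
      φ d - φ (suc d) ≡⟨ solve 2 (λ p q → p := p :* con 1ℚ :+ q :* con 0ℚ) refl (φ d - φ (suc d)) q ⟩
      (φ d - φ (suc d)) * 1ℚ + q * 0ℚ ≡⟨ cong₂ (λ s t → (φ d - φ (suc d)) * s + q * t) (δ-refl d) (δ-≢ {suc (suc d)} {d} (λ ())) ⟨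
      _ ∎
      where
      open ≡-Reasoning
      q = φ (suc (suc d)) - φ (suc d)
    step φ i d d≤1+i i≤1+d | tri> _ _ i<d with ℕ.≤-antisym d≤1+i i<d
    ... | refl = begin
      q ≡⟨ solve 2 (λ p q → q := p :* con 0ℚ :+ q :* con 1ℚ) refl p q ⟩
      p * 0ℚ + q * 1ℚ ≡⟨ cong₂ (λ s t → p * s + q * t) (δ-≢ (ℕ.<⇒≢ (s≤s (ℕ.m∸n≤m i 1)))) (δ-refl d) ⟨
      _ ∎
      where
      open ≡-Reasoning
      p = φ (i ∸ 1) - φ i
      q = φ (suc i) - φ i
    step φ zero d d≤1+i i≤1+d | tri≈ _ refl _ =
      solve 2 (λ p q → p :- p := (p :- p) :* con 1ℚ :+ (q :- p) :* con 0ℚ) refl (φ 0) (φ 1)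
    step φ (suc i) d d≤1+i i≤1+d | tri≈ _ refl _ = begin
      φ (suc i) - φ (suc i) ≡⟨ solve 3 (λ o p q → p :- p := o :* con 0ℚ :+ q :* con 0ℚ) refl (φ i - φ (suc i)) (φ (suc i)) q ⟩
      (φ i - φ (suc i)) * 0ℚ + q * 0ℚ ≡⟨ cong₂ (λ s t → (φ i - φ (suc i)) * s + q * t) (δ-≢ (ℕ.<⇒≢ (ℕ.n<1+n i))) (δ-≢ (ℕ.<⇒≢ (ℕ.n<1+n (suc i)) ∘ sym)) ⟨
      _ ∎
      where
      open ≡-Reasoning
      q = φ (suc (suc i)) - φ (suc i)

  laplace-radial : ∀ x (φ : ℕ → ℚ) y → laplace (λ z → φ (dist x z)) y ≡ Δ φ (dist x y)
  laplace-radial x φ y = begin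
    ∑ (λ z → A y z * (φ (dist x z) - φ i))
      ≡⟨ ∑-cong split ⟩
    ∑ (λ z → p * (A y z * δ (i ∸ 1) (dist x z)) + q * (A y z * δ (suc i) (dist x z)))
      ≡⟨ ∑-+-* q _ _ ⟩
    ∑ (λ z → p * (A y z * δ (i ∸ 1) (dist x z))) + q * ∑ (λ z → A y z * δ (suc i) (dist x z))
      ≡⟨ cong₂ _+_ (∑-*ˡ p _) (cong (q *_) (trans (sym (nbrs-sum x y (suc i))) (cong ℕtoℚ (proj₂ (regular-at x y))))) ⟩
    p * ∑ (λ z → A y z * δ (i ∸ 1) (dist x z)) + q * ℕtoℚ (b i)
      ≡⟨ cong (λ t → p * t + q * ℕtoℚ (b i)) (trans (sym (nbrs-sum x y (i ∸ 1))) (cong ℕtoℚ (proj₁ (regular-at x y)))) ⟩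
    Δ φ i ∎
    where
    open ≡-Reasoning
    i = dist x y
    p = φ (i ∸ 1) - φ i
    q = φ (suc i) - φ i
    split : ∀ z → A y z * (φ (dist x z) - φ i) ≡ p * (A y z * δ (i ∸ 1) (dist x z)) + q * (A y z * δ (suc i) (dist x z))
    split z with adj y z in eq
    ... | false = solve 5 (λ r p s q t → con 0ℚ :* r := p :* (con 0ℚ :* s) :+ q :* (con 0ℚ :* t)) refl
                    (φ (dist x z) - φ i) p (δ (i ∸ 1) (dist x z)) q (δ (suc i) (dist x z))
    ... | true = begin
      1ℚ * (φ (dist x z) - φ i) ≡⟨ *-identityˡ _ ⟩
      φ (dist x z) - φ i ≡⟨ step φ i (dist x z) (dist-adj yz x) (dist-adj (adj-sym yz) x) ⟩
      p * δ (i ∸ 1) (dist x z) + q * δ (suc i) (dist x z)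
        ≡⟨ cong₂ (λ s t → p * s + q * t) (*-identityˡ (δ (i ∸ 1) (dist x z))) (*-identityˡ (δ (suc i) (dist x z))) ⟨
      _ ∎
      where
      yz : Adj y z
      yz = from T-≡ eq

  -- The off-diagonal part `F` is transposed by exchanging the two sums and using the symmetry of
  -- adjacency; the diagonal part `G` is common to both sides.
  laplace-self-adjoint : ∀ h g → ∑ (λ y → h y * laplace g y) ≡ ∑ (λ y → laplace h y * g y)
  laplace-self-adjoint h g = begin
    ∑ (λ y → h y * laplace g y)
      ≡⟨ ∑-cong (λ y → trans (sym (∑-*ˡ (h y) _)) (∑-cong λ z →
           solve 4 (λ a u v w → u :* (a :* (v :- w)) := a :* (u :* v) :+ :- con 1ℚ :* (a :* (u :* w))) refl (A y z) (h y) (g z) (g y))) ⟩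
    ∑ (λ y → ∑ (λ z → F y z + - 1ℚ * G y z)) ≡⟨ split F ⟩
    ∑ (λ y → ∑ (F y)) + - 1ℚ * ∑ (λ y → ∑ (G y)) ≡⟨ cong (_+ - 1ℚ * ∑ (λ y → ∑ (G y))) (∑-swap F) ⟩
    ∑ (λ z → ∑ (λ y → F y z)) + - 1ℚ * ∑ (λ y → ∑ (G y)) ≡⟨ split (λ y z → F z y) ⟨
    ∑ (λ y → ∑ (λ z → F z y + - 1ℚ * G y z))
      ≡⟨ ∑-cong (λ y → ∑-cong λ z → trans (cong (λ t → 𝟙 t * (h z * g y) + - 1ℚ * G y z) (symm z y))
           (solve 4 (λ a u v w → a :* (u :* v) :+ :- con 1ℚ :* (a :* (w :* v)) := v :* (a :* (u :- w))) refl (A y z) (h z) (g y) (h y))) ⟩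
    ∑ (λ y → ∑ (λ z → g y * (A y z * (h z - h y))))
      ≡⟨ ∑-cong (λ y → trans (∑-*ˡ (g y) _) (*-comm (g y) (laplace h y))) ⟩
    ∑ (λ y → laplace h y * g y) ∎
    where
    open ≡-Reasoning
    F G : Matrix n
    F y z = A y z * (h y * g z)
    G y z = A y z * (h y * g y)
    split : ∀ (F : Matrix n) → ∑ (λ y → ∑ (λ z → F y z + - 1ℚ * G y z)) ≡ ∑ (λ y → ∑ (F y)) + - 1ℚ * ∑ (λ y → ∑ (G y))
    split F = trans (∑-cong λ y → ∑-+-* (- 1ℚ) (F y) (G y)) (∑-+-* (- 1ℚ) _ _)

  radial-self-adjoint : ∀ x φ g → ∑ (λ z → φ (dist x z) * laplace g z) ≡ ∑ (λ z → Δ φ (dist x z) * g z)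
  radial-self-adjoint x φ g = trans (laplace-self-adjoint (λ z → φ (dist x z)) g) (∑-cong λ z → cong (_* g z) (laplace-radial x φ z))

  -- Self-adjointness paired with the constant 1, which the Laplacian annihilates.
  ∑-Δ : ∀ x φ → ∑ (λ z → Δ φ (dist x z)) ≡ 0ℚ
  ∑-Δ x φ = begin
    ∑ (λ z → Δ φ (dist x z))        ≡⟨ ∑-cong (λ z → sym (*-identityʳ _)) ⟩
    ∑ (λ z → Δ φ (dist x z) * 1ℚ)   ≡⟨ radial-self-adjoint x φ (λ _ → 1ℚ) ⟨
    ∑ (λ z → φ (dist x z) * laplace (λ _ → 1ℚ) z)
      ≡⟨ ∑-zero (λ z → trans (cong (φ (dist x z) *_) (∑-zero λ w → *-zeroʳ (A z w))) (*-zeroʳ (φ (dist x z)))) ⟩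
    0ℚ ∎
    where open ≡-Reasoning

  ∑-at : ∀ x g → ∑ (λ z → δ 0 (dist x z) * g z) ≡ g x
  ∑-at x g = ∑-δ g x _ (trans (cong (δ 0) (dist-refl x)) (δ-refl 0))
    (λ z z≢x → δ-≢ λ 0≡d → z≢x (sym (dist-zero (sym 0≡d))))

  private
    descend : ∀ {i m} → i ≤′ m → ∃[ y ] dist x₀ y ≡ m → ∃[ y ] dist x₀ y ≡ i
    descend ≤′-refl     found    = found
    descend (≤′-step p) (y , eq) with predecessor eq
    ... | z , eq′ , _ = descend p (z , eq′)

  at-distance : ∀ {i} → i ≤ D → ∃[ y ] dist x₀ y ≡ i
  at-distance i≤D = descend (ℕ.≤⇒≤′ i≤D) (y₀ , distIs⇒dist x₀ y₀ D (from T-≡ far))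

  nbrsAt-positive : ∀ {x y z j} → Adj y z → dist x z ≡ j → 0 < nbrsAt Γ x y j
  nbrsAt-positive {x} {y} {z} {j} a eq =
    filter-some (T? ∘ (λ z → adj y z ∧ distIs Γ x z j)) (lose (∈-allFin z) (from T-∧ (a , dist⇒distIs x z j eq)))

  c-positive : ∀ {i} → i < D → 0 < c (suc i)
  c-positive {i} i<D with at-distance i<D
  ... | y , eq with predecessor eq
  ...   | z , eq′ , a = subst (0 <_) (proj₁ (regular (suc i) i<D x₀ y (T⇒true (dist⇒distIs x₀ y _ eq))))
                          (nbrsAt-positive (adj-sym a) eq′)

  b-positive : ∀ {i} → i < D → 0 < b i
  b-positive {i} i<D with at-distance i<D
  ... | y , eq with predecessor eq
  ...   | z , eq′ , a = subst (0 <_) (proj₂ (regular i (ℕ.<⇒≤ i<D) x₀ z (T⇒true (dist⇒distIs x₀ z _ eq′))))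
                          (nbrsAt-positive a eq)

  -- Outside the ball of radius `m`, only vertices at distance `m + 1` have neighbours on the sphere
  -- of radius `m`, namely `c (suc m)` each.
  Δ-δ : ∀ m e → m < e → Δ (δ m) e ≡ ℕtoℚ (c (suc m)) * δ (suc m) e
  Δ-δ m (suc e) m<1+e with m ℕ.≟ e
  ... | yes refl = begin
    (δ m m - δ m (suc m)) * C + (δ m (suc (suc m)) - δ m (suc m)) * B
      ≡⟨ cong₂ (λ s t → (δ m m - s) * C + (t - s) * B) (δ-≢ (ℕ.<⇒≢ (ℕ.n<1+n m))) (δ-≢ (ℕ.<⇒≢ (s≤s (ℕ.n≤1+n m)))) ⟩
    (δ m m - 0ℚ) * C + (0ℚ - 0ℚ) * B
      ≡⟨ solve 3 (λ d p q → (d :- con 0ℚ) :* p :+ (con 0ℚ :- con 0ℚ) :* q := p :* d) refl (δ m m) C B ⟩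
    C * δ m m ∎
    where
    open ≡-Reasoning
    C = ℕtoℚ (c (suc m))
    B = ℕtoℚ (b (suc m))
  ... | no m≢e = begin
    (δ m e - δ m (suc e)) * C + (δ m (suc (suc e)) - δ m (suc e)) * B
      ≡⟨ cong₂ (λ s t → (δ m e - s) * C + (t - s) * B) (δ-≢ (ℕ.<⇒≢ m<1+e)) (δ-≢ (ℕ.<⇒≢ (ℕ.m<n⇒m<1+n m<1+e))) ⟩
    (δ m e - 0ℚ) * C + (0ℚ - 0ℚ) * B
      ≡⟨ cong (λ s → (s - 0ℚ) * C + (0ℚ - 0ℚ) * B) (δ-≢ m≢e) ⟩
    (0ℚ - 0ℚ) * C + (0ℚ - 0ℚ) * B
      ≡⟨ solve 3 (λ d p q → (con 0ℚ :- con 0ℚ) :* p :+ (con 0ℚ :- con 0ℚ) :* q := d :* con 0ℚ) refl (ℕtoℚ (c (suc m))) C B ⟩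
    ℕtoℚ (c (suc m)) * 0ℚ
      ≡⟨ cong (ℕtoℚ (c (suc m)) *_) (δ-≢ m≢e) ⟨
    ℕtoℚ (c (suc m)) * δ m e ∎
    where
    open ≡-Reasoning
    C = ℕtoℚ (c (suc e))
    B = ℕtoℚ (b (suc e))

  -- Counting vertices on geodesics

  module Geodesics (x y : Fin n) where

    layer : ℕ → ℕ → ℕ
    layer j m = length (filterᵇ (λ z → (j ≡ᵇ dist x z) ∧ (m ≡ᵇ dist y z)) (allFin n))

    layer-sum : ∀ j m → ℕtoℚ (layer j m) ≡ ∑ (λ z → δ j (dist x z) * δ m (dist y z))
    layer-sum j m = trans (ℕtoℚ-count _) (∑-cong λ z → 𝟙-∧ (j ≡ᵇ dist x z) (m ≡ᵇ dist y z))

    -- A double count of the edges between two consecutive layers of the geodesics from `x` to `y`: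
    -- the sum of `δ j` around `x` against the Laplacian of `δ m` around `y` is evaluated from both
    -- ends.
    layer-step : ∀ j m → dist x y ≡ suc (j ℕ.+ m) → c (suc j) ℕ.* layer (suc j) m ≡ c (suc m) ℕ.* layer j (suc m)
    layer-step j m eq = ℕtoℚ-injective (begin
      ℕtoℚ (c (suc j) ℕ.* layer (suc j) m)
        ≡⟨ trans (ℕtoℚ-* (c (suc j)) (layer (suc j) m)) (cong (ℕtoℚ (c (suc j)) *_) (layer-sum (suc j) m)) ⟩
      ℕtoℚ (c (suc j)) * ∑ (λ z → δ (suc j) (dist x z) * δ m (dist y z))
        ≡⟨ ∑-*ˡ (ℕtoℚ (c (suc j))) _ ⟨
      ∑ (λ z → ℕtoℚ (c (suc j)) * (δ (suc j) (dist x z) * δ m (dist y z)))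
        ≡⟨ ∑-cong (λ z → trans (*-comm (Δ (δ j) (dist x z)) (δ m (dist y z))) (trans
             (guard m j (dist y z) (dist x z) (subst (_≤ dist y z ℕ.+ dist x z) (cong suc (ℕ.+-comm j m)) (subst (_≤ dist y z ℕ.+ dist x z) eq (subst (dist x y ≤_) (ℕ.+-comm (dist x z) (dist y z)) (bound z)))))
             (solve 3 (λ p q r → p :* (q :* r) := q :* (r :* p)) refl (δ m (dist y z)) (ℕtoℚ (c (suc j))) (δ (suc j) (dist x z))))) ⟨
      ∑ (λ z → Δ (δ j) (dist x z) * δ m (dist y z))
        ≡⟨ radial-self-adjoint x (δ j) (λ z → δ m (dist y z)) ⟨
      ∑ (λ z → δ j (dist x z) * laplace (λ w → δ m (dist y w)) z)
        ≡⟨ ∑-cong (λ z → trans (cong (δ j (dist x z) *_) (laplace-radial y (δ m) z)) (trans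
             (guard j m (dist x z) (dist y z) (subst (_≤ dist x z ℕ.+ dist y z) eq (bound z)))
             (solve 3 (λ p q r → p :* (q :* r) := q :* (p :* r)) refl (δ j (dist x z)) (ℕtoℚ (c (suc m))) (δ (suc m) (dist y z))))) ⟩
      ∑ (λ z → ℕtoℚ (c (suc m)) * (δ j (dist x z) * δ (suc m) (dist y z)))
        ≡⟨ ∑-*ˡ (ℕtoℚ (c (suc m))) _ ⟩
      ℕtoℚ (c (suc m)) * ∑ (λ z → δ j (dist x z) * δ (suc m) (dist y z))
        ≡⟨ trans (ℕtoℚ-* (c (suc m)) (layer j (suc m))) (cong (ℕtoℚ (c (suc m)) *_) (layer-sum j (suc m))) ⟨
      ℕtoℚ (c (suc m) ℕ.* layer j (suc m)) ∎)
      where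
      open ≡-Reasoning
      bound : ∀ z → dist x y ≤ dist x z ℕ.+ dist y z
      bound z = subst (λ d → dist x y ≤ dist x z ℕ.+ d) (dist-sym z y) (dist-triangle x z y)
      -- The triangle inequality forces `e > m` wherever `δ j d` is nonzero, which is the range
      -- where `Δ-δ` applies.
      guard : ∀ j m d e → suc (j ℕ.+ m) ≤ d ℕ.+ e →
              δ j d * Δ (δ m) e ≡ δ j d * (ℕtoℚ (c (suc m)) * δ (suc m) e)
      guard j m d e le with j ℕ.≟ d
      ... | yes refl = cong (δ j j *_) (Δ-δ m e (ℕ.+-cancelˡ-≤ j (suc m) e (subst (_≤ j ℕ.+ e) (sym (ℕ.+-suc j m)) le)))
      ... | no j≢d = trans (cong (_* Δ (δ m) e) (δ-≢ j≢d)) (trans (*-zeroˡ (Δ (δ m) e))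
              (sym (trans (cong (_* (ℕtoℚ (c (suc m)) * δ (suc m) e)) (δ-≢ j≢d)) (*-zeroˡ (ℕtoℚ (c (suc m)) * δ (suc m) e)))))

    layer-zero : layer 0 (dist x y) ≡ 1
    layer-zero = ℕtoℚ-injective (begin
      ℕtoℚ (layer 0 (dist x y))                               ≡⟨ layer-sum 0 (dist x y) ⟩
      ∑ (λ z → δ 0 (dist x z) * δ (dist x y) (dist y z))      ≡⟨ ∑-at x (λ z → δ (dist x y) (dist y z)) ⟩
      δ (dist x y) (dist y x)                                 ≡⟨ cong (δ (dist x y)) (dist-sym y x) ⟩
      δ (dist x y) (dist x y)                                 ≡⟨ δ-refl (dist x y) ⟩
      1ℚ                                                      ∎)
      where open ≡-Reasoning

    c! : ℕ → ℕ
    c! = factorial (c ∘ suc)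

    layer-factorial : ∀ j m → dist x y ≡ j ℕ.+ m → layer j m ℕ.* (c! j ℕ.* c! m) ≡ c! (j ℕ.+ m)
    layer-factorial zero    m refl = trans (cong₂ ℕ._*_ layer-zero (ℕ.*-identityˡ (c! m))) (ℕ.*-identityˡ (c! m))
    layer-factorial (suc j) m eq = begin
      layer (suc j) m ℕ.* (c (suc j) ℕ.* c! j ℕ.* c! m)
        ≡⟨ S.solve 4 (λ l p q r → l S.:* (p S.:* q S.:* r) S.:= p S.:* l S.:* (q S.:* r)) refl (layer (suc j) m) (c (suc j)) (c! j) (c! m) ⟩
      c (suc j) ℕ.* layer (suc j) m ℕ.* (c! j ℕ.* c! m)
        ≡⟨ cong (ℕ._* (c! j ℕ.* c! m)) (layer-step j m eq) ⟩
      c (suc m) ℕ.* layer j (suc m) ℕ.* (c! j ℕ.* c! m)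
        ≡⟨ S.solve 4 (λ l p q r → p S.:* l S.:* (q S.:* r) S.:= l S.:* (q S.:* (p S.:* r))) refl (layer j (suc m)) (c (suc m)) (c! j) (c! m) ⟩
      layer j (suc m) ℕ.* (c! j ℕ.* c! (suc m))
        ≡⟨ layer-factorial j (suc m) (trans eq (sym (ℕ.+-suc j m))) ⟩
      c! (j ℕ.+ suc m)
        ≡⟨ cong c! (ℕ.+-suc j m) ⟩
      c! (suc j ℕ.+ m) ∎
      where
      open ≡-Reasoning

  -- The quotient is the intersection number p^{j+m}_{j,m}.
  c!-∣ : ∀ j m → j ℕ.+ m ≤ D → factorial (c ∘ suc) j ℕ.* factorial (c ∘ suc) m ∣ factorial (c ∘ suc) (j ℕ.+ m)
  c!-∣ j m le with at-distance le
  ... | y , eq = divides (layer j m) (sym (layer-factorial j m eq))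
    where open Geodesics x₀ y

  -- Sphere sizes

  sphere : ℕ → ℕ
  sphere i = length (filterᵇ (λ z → i ≡ᵇ dist x₀ z) (allFin n))

  sphere-sum : ∀ i → ℕtoℚ (sphere i) ≡ ∑ (λ z → δ i (dist x₀ z))
  sphere-sum i = ℕtoℚ-count _

  sphere-zero : sphere 0 ≡ 1
  sphere-zero = ℕtoℚ-injective (trans (sphere-sum 0) (trans (∑-cong λ z → sym (*-identityʳ (δ 0 (dist x₀ z)))) (∑-at x₀ (λ _ → 1ℚ))))

  below : ℕ → ℕ → ℚ
  below i e = 𝟙 (e <ᵇ suc i)

  below-yes : ∀ {i e} → e ≤ i → below i e ≡ 1ℚ
  below-yes e≤i = 𝟙-yes (ℕ.<⇒<ᵇ (s≤s e≤i))

  below-no : ∀ {i e} → i < e → below i e ≡ 0ℚ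
  below-no {i} {e} i<e = 𝟙-no (λ t → ℕ.<⇒≱ i<e (s≤s⁻¹ (ℕ.<ᵇ⇒< e (suc i) t)))

  Δ-values : ∀ φ e {u v w} → φ (e ∸ 1) ≡ u → φ e ≡ v → φ (suc e) ≡ w →
             Δ φ e ≡ (u - v) * ℕtoℚ (c e) + (w - v) * ℕtoℚ (b e)
  Δ-values φ e refl refl refl = refl

  -- The Laplacian of the indicator of a ball lives on the two spheres along its boundary. Summed
  -- over all vertices it balances the edges counted from outside against those counted from inside.
  Δ-below : ∀ i e → Δ (below i) e ≡ ℕtoℚ (c (suc i)) * δ (suc i) e + - ℕtoℚ (b i) * δ i e
  Δ-below i e with ℕ.<-cmp e i
  ... | tri< e<i e≢i _ = begin
    Δ (below i) e
      ≡⟨ Δ-values (below i) e (below-yes (ℕ.≤-trans (ℕ.m∸n≤m e 1) (ℕ.<⇒≤ e<i))) (below-yes (ℕ.<⇒≤ e<i)) (below-yes e<i) ⟩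
    (1ℚ - 1ℚ) * ℕtoℚ (c e) + (1ℚ - 1ℚ) * ℕtoℚ (b e)
      ≡⟨ solve 4 (λ p q r s → (con 1ℚ :- con 1ℚ) :* p :+ (con 1ℚ :- con 1ℚ) :* q := r :* con 0ℚ :+ :- s :* con 0ℚ)
           refl (ℕtoℚ (c e)) (ℕtoℚ (b e)) (ℕtoℚ (c (suc i))) (ℕtoℚ (b i)) ⟩
    ℕtoℚ (c (suc i)) * 0ℚ + - ℕtoℚ (b i) * 0ℚ
      ≡⟨ cong₂ (λ s t → ℕtoℚ (c (suc i)) * s + - ℕtoℚ (b i) * t) (δ-≢ (ℕ.<⇒≢ (ℕ.m<n⇒m<1+n e<i) ∘ sym)) (δ-≢ (e≢i ∘ sym)) ⟨
    _ ∎
    where open ≡-Reasoning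
  ... | tri≈ _ refl _ = begin
    Δ (below i) i
      ≡⟨ Δ-values (below i) i (below-yes (ℕ.m∸n≤m i 1)) (below-yes (ℕ.≤-refl {i})) (below-no (ℕ.n<1+n i)) ⟩
    (1ℚ - 1ℚ) * ℕtoℚ (c i) + (0ℚ - 1ℚ) * ℕtoℚ (b i)
      ≡⟨ solve 3 (λ p q r → (con 1ℚ :- con 1ℚ) :* p :+ (con 0ℚ :- con 1ℚ) :* q := r :* con 0ℚ :+ :- q :* con 1ℚ)
           refl (ℕtoℚ (c i)) (ℕtoℚ (b i)) (ℕtoℚ (c (suc i))) ⟩
    ℕtoℚ (c (suc i)) * 0ℚ + - ℕtoℚ (b i) * 1ℚ
      ≡⟨ cong₂ (λ s t → ℕtoℚ (c (suc i)) * s + - ℕtoℚ (b i) * t) (δ-≢ (ℕ.<⇒≢ (ℕ.n<1+n i) ∘ sym)) (δ-refl i) ⟨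
    _ ∎
    where open ≡-Reasoning
  ... | tri> _ _ i<e with e ℕ.≟ suc i
  ...   | yes refl = begin
    Δ (below i) (suc i)
      ≡⟨ Δ-values (below i) (suc i) (below-yes (ℕ.≤-refl {i})) (below-no (ℕ.n<1+n i)) (below-no (ℕ.m<n⇒m<1+n (ℕ.n<1+n i))) ⟩
    (1ℚ - 0ℚ) * ℕtoℚ (c (suc i)) + (0ℚ - 0ℚ) * ℕtoℚ (b (suc i))
      ≡⟨ solve 3 (λ p q r → (con 1ℚ :- con 0ℚ) :* p :+ (con 0ℚ :- con 0ℚ) :* q := p :* con 1ℚ :+ :- r :* con 0ℚ)
           refl (ℕtoℚ (c (suc i))) (ℕtoℚ (b (suc i))) (ℕtoℚ (b i)) ⟩
    ℕtoℚ (c (suc i)) * 1ℚ + - ℕtoℚ (b i) * 0ℚ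
      ≡⟨ cong₂ (λ s t → ℕtoℚ (c (suc i)) * s + - ℕtoℚ (b i) * t) (δ-refl (suc i)) (δ-≢ (ℕ.<⇒≢ (ℕ.n<1+n i))) ⟨
    _ ∎
    where open ≡-Reasoning
  ...   | no e≢1+i = begin
    Δ (below i) e
      ≡⟨ Δ-values (below i) e (below-no (i<e∸1 e i<e e≢1+i)) (below-no i<e) (below-no (ℕ.m<n⇒m<1+n i<e)) ⟩
    (0ℚ - 0ℚ) * ℕtoℚ (c e) + (0ℚ - 0ℚ) * ℕtoℚ (b e)
      ≡⟨ solve 4 (λ p q r s → (con 0ℚ :- con 0ℚ) :* p :+ (con 0ℚ :- con 0ℚ) :* q := r :* con 0ℚ :+ :- s :* con 0ℚ)
           refl (ℕtoℚ (c e)) (ℕtoℚ (b e)) (ℕtoℚ (c (suc i))) (ℕtoℚ (b i)) ⟩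
    ℕtoℚ (c (suc i)) * 0ℚ + - ℕtoℚ (b i) * 0ℚ
      ≡⟨ cong₂ (λ s t → ℕtoℚ (c (suc i)) * s + - ℕtoℚ (b i) * t) (δ-≢ (e≢1+i ∘ sym)) (δ-≢ (ℕ.<⇒≢ i<e)) ⟨
    _ ∎
    where
    open ≡-Reasoning
    i<e∸1 : ∀ e → i < e → e ≢ suc i → i < e ∸ 1
    i<e∸1 (suc e) i<1+e 1+e≢1+i = ℕ.≤∧≢⇒< (s≤s⁻¹ i<1+e) (1+e≢1+i ∘ cong suc ∘ sym)

  sphere-step : ∀ i → sphere (suc i) ℕ.* c (suc i) ≡ b i ℕ.* sphere i
  sphere-step i = ℕtoℚ-injective (begin
    ℕtoℚ (sphere (suc i) ℕ.* c (suc i)) ≡⟨ ℕtoℚ-* (sphere (suc i)) (c (suc i)) ⟩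
    ℕtoℚ (sphere (suc i)) * ℕtoℚ (c (suc i))
      ≡⟨ solve 4 (λ p q r s → p :* q := (q :* p :+ :- r :* s) :+ r :* s) refl (ℕtoℚ (sphere (suc i))) (ℕtoℚ (c (suc i))) (ℕtoℚ (b i)) (ℕtoℚ (sphere i)) ⟩
    (ℕtoℚ (c (suc i)) * ℕtoℚ (sphere (suc i)) + - ℕtoℚ (b i) * ℕtoℚ (sphere i)) + ℕtoℚ (b i) * ℕtoℚ (sphere i)
      ≡⟨ cong (_+ ℕtoℚ (b i) * ℕtoℚ (sphere i)) flow ⟩
    0ℚ + ℕtoℚ (b i) * ℕtoℚ (sphere i) ≡⟨ +-identityˡ _ ⟩
    ℕtoℚ (b i) * ℕtoℚ (sphere i) ≡⟨ ℕtoℚ-* (b i) (sphere i) ⟨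
    ℕtoℚ (b i ℕ.* sphere i) ∎)
    where
    open ≡-Reasoning
    flow : ℕtoℚ (c (suc i)) * ℕtoℚ (sphere (suc i)) + - ℕtoℚ (b i) * ℕtoℚ (sphere i) ≡ 0ℚ
    flow = begin
      ℕtoℚ (c (suc i)) * ℕtoℚ (sphere (suc i)) + - ℕtoℚ (b i) * ℕtoℚ (sphere i)
        ≡⟨ cong₂ _+_ (trans (cong (ℕtoℚ (c (suc i)) *_) (sphere-sum (suc i))) (sym (∑-*ˡ (ℕtoℚ (c (suc i))) _)))
                     (cong (- ℕtoℚ (b i) *_) (sphere-sum i)) ⟩
      ∑ (λ z → ℕtoℚ (c (suc i)) * δ (suc i) (dist x₀ z)) + - ℕtoℚ (b i) * ∑ (λ z → δ i (dist x₀ z))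
        ≡⟨ ∑-+-* (- ℕtoℚ (b i)) _ _ ⟨
      ∑ (λ z → ℕtoℚ (c (suc i)) * δ (suc i) (dist x₀ z) + - ℕtoℚ (b i) * δ i (dist x₀ z))
        ≡⟨ ∑-cong (λ z → sym (Δ-below i (dist x₀ z))) ⟩
      ∑ (λ z → Δ (below i) (dist x₀ z))
        ≡⟨ ∑-Δ x₀ (below i) ⟩
      0ℚ ∎

  c!-∣-b! : ∀ i → factorial (c ∘ suc) i ∣ factorial b i
  c!-∣-b! i = divides (sphere i) (sym (go i))
    where
    open ≡-Reasoning
    go : ∀ i → sphere i ℕ.* factorial (c ∘ suc) i ≡ factorial b i
    go zero    = cong (ℕ._* 1) sphere-zero
    go (suc i) = begin
      sphere (suc i) ℕ.* (c (suc i) ℕ.* factorial (c ∘ suc) i) ≡⟨ ℕ.*-assoc (sphere (suc i)) _ _ ⟨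
      sphere (suc i) ℕ.* c (suc i) ℕ.* factorial (c ∘ suc) i   ≡⟨ cong (ℕ._* factorial (c ∘ suc) i) (sphere-step i) ⟩
      b i ℕ.* sphere i ℕ.* factorial (c ∘ suc) i               ≡⟨ ℕ.*-assoc (b i) _ _ ⟩
      b i ℕ.* (sphere i ℕ.* factorial (c ∘ suc) i)             ≡⟨ cong (b i ℕ.*_) (go i) ⟩
      b i ℕ.* factorial b i                                    ∎

  -- Radial kernels and multiplicities

  Eigenfunction : ℚ → (Fin n → ℚ) → Set
  Eigenfunction η g = ∀ y → laplace g y ≡ η * g y

  -- Modulo the image of Δ - η, which the kernel operator annihilates on
  -- eigenfunctions, every h : ℕ → ℚ is a multiple of δ 0.
  kernel-scalar : ∀ η h → ∃[ μ ] ∀ g → Eigenfunction η g → ∀ x → ∑ (λ z → h (dist x z) * g z) ≡ μ * g x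
  kernel-scalar η h = go D h ℕ.≤-refl (λ j D<j j≤D → ⊥-elim (ℕ.<⇒≱ D<j j≤D))
    where
    open ≡-Reasoning
    go : ∀ k h → k ≤ D → (∀ j → k < j → j ≤ D → h j ≡ 0ℚ) →
         ∃[ μ ] ∀ g → Eigenfunction η g → ∀ x → ∑ (λ z → h (dist x z) * g z) ≡ μ * g x
    go zero h _ h≡0 = h 0 , λ g _ x → begin
      ∑ (λ z → h (dist x z) * g z)              ≡⟨ ∑-cong (λ z → trans (cong (_* g z) (point (dist x z) (dist≤D x z))) (*-assoc (h 0) (δ 0 (dist x z)) (g z))) ⟩
      ∑ (λ z → h 0 * (δ 0 (dist x z) * g z))    ≡⟨ ∑-*ˡ (h 0) _ ⟩
      h 0 * ∑ (λ z → δ 0 (dist x z) * g z)      ≡⟨ cong (h 0 *_) (∑-at x g) ⟩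
      h 0 * g x                                 ∎
      where
      point : ∀ d → d ≤ D → h d ≡ h 0 * δ 0 d
      point zero    _   = sym (*-identityʳ (h 0))
      point (suc d) d<D = trans (h≡0 (suc d) (s≤s z≤n) d<D) (sym (*-zeroʳ (h 0)))
    go (suc k) h k<D h≡0 = eliminate (recip (ℕtoℚ-≢0 (c-positive k<D)))
      where
      C = ℕtoℚ (c (suc k))
      eliminate : ∃[ s ] C * s ≡ 1ℚ →
                  ∃[ μ ] ∀ g → Eigenfunction η g → ∀ x → ∑ (λ z → h (dist x z) * g z) ≡ μ * g x
      eliminate (s , Cs≡1) = proj₁ smaller , λ g eigen x → trans (sym (same g eigen x)) (proj₂ smaller g eigen x)
        where
        r = h (suc k) * s
        -- At `k + 1` the function `Δ (δ k) - η δ k` has the value `C`, so `r = h (suc k) / C`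
        -- removes the outermost value of `h`.
        h′ : ℕ → ℚ
        h′ j = h j + - r * (Δ (δ k) j + - η * δ k j)
        h′≡0 : ∀ j → k < j → j ≤ D → h′ j ≡ 0ℚ
        h′≡0 j k<j j≤D = trans (cong₂ (λ p q → h j + - r * (p + - η * q)) (Δ-δ k j k<j) (δ-≢ (ℕ.<⇒≢ k<j))) (rest (suc k ℕ.≟ j))
          where
          rest : Dec (suc k ≡ j) → h j + - r * (C * δ (suc k) j + - η * 0ℚ) ≡ 0ℚ
          rest (yes refl) = begin
            h (suc k) + - r * (C * δ k k + - η * 0ℚ)   ≡⟨ cong (λ p → h (suc k) + - r * (C * p + - η * 0ℚ)) (δ-refl k) ⟩
            h (suc k) + - r * (C * 1ℚ + - η * 0ℚ)
              ≡⟨ solve 4 (λ h s C η → h :+ :- (h :* s) :* (C :* con 1ℚ :+ :- η :* con 0ℚ) := h :* (con 1ℚ :- C :* s)) refl (h (suc k)) s C η ⟩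
            h (suc k) * (1ℚ - C * s)                   ≡⟨ cong (λ p → h (suc k) * (1ℚ - p)) Cs≡1 ⟩
            h (suc k) * 0ℚ                             ≡⟨ *-zeroʳ (h (suc k)) ⟩
            0ℚ                                         ∎
          rest (no 1+k≢j) = begin
            h j + - r * (C * δ (suc k) j + - η * 0ℚ)
              ≡⟨ cong₂ (λ p q → p + - r * (C * q + - η * 0ℚ)) (h≡0 j (ℕ.≤∧≢⇒< k<j 1+k≢j) j≤D) (δ-≢ 1+k≢j) ⟩
            0ℚ + - r * (C * 0ℚ + - η * 0ℚ)
              ≡⟨ solve 3 (λ r C η → con 0ℚ :+ :- r :* (C :* con 0ℚ :+ :- η :* con 0ℚ) := con 0ℚ) refl r C η ⟩
            0ℚ                                         ∎
        smaller : ∃[ μ ] ∀ g → Eigenfunction η g → ∀ x → ∑ (λ z → h′ (dist x z) * g z) ≡ μ * g x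
        smaller = go k h′ (ℕ.<⇒≤ k<D) h′≡0
        same : ∀ g → Eigenfunction η g → ∀ x →
               ∑ (λ z → h′ (dist x z) * g z) ≡ ∑ (λ z → h (dist x z) * g z)
        same g eigen x = begin
          ∑ (λ z → h′ (dist x z) * g z)
            ≡⟨ ∑-cong (λ z → solve 6 (λ h r p η q g → (h :+ :- r :* (p :+ :- η :* q)) :* g := h :* g :+ :- r :* (p :* g :+ :- η :* (q :* g)))
                 refl (h (dist x z)) r (Δ (δ k) (dist x z)) η (δ k (dist x z)) (g z)) ⟩
          ∑ (λ z → h (dist x z) * g z + - r * (Δ (δ k) (dist x z) * g z + - η * (δ k (dist x z) * g z)))
            ≡⟨ trans (∑-+-* (- r) _ _) (cong (λ t → Hg + - r * t) (∑-+-* (- η) _ _)) ⟩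
          Hg + - r * (∑ (λ z → Δ (δ k) (dist x z) * g z) + - η * Kg)
            ≡⟨ cong (λ t → Hg + - r * (t + - η * Kg)) (begin
                 ∑ (λ z → Δ (δ k) (dist x z) * g z)          ≡⟨ radial-self-adjoint x (δ k) g ⟨
                 ∑ (λ z → δ k (dist x z) * laplace g z)      ≡⟨ ∑-cong (λ z → trans (cong (δ k (dist x z) *_) (eigen z))
                                                                  (solve 3 (λ p q t → p :* (q :* t) := q :* (p :* t)) refl (δ k (dist x z)) η (g z))) ⟩
                 ∑ (λ z → η * (δ k (dist x z) * g z))        ≡⟨ ∑-*ˡ η _ ⟩
                 η * Kg                                      ∎) ⟩
          Hg + - r * (η * Kg + - η * Kg)
            ≡⟨ solve 4 (λ h r η k → h :+ :- r :* (η :* k :+ :- η :* k) := h) refl Hg r η Kg ⟩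
          Hg ∎
          where
          Hg = ∑ (λ z → h (dist x z) * g z)
          Kg = ∑ (λ z → δ k (dist x z) * g z)

  -- Every `f (dist y z)` is an eigenfunction in `z`, so by `kernel-scalar` the matrix
  -- `f (dist x y)` has square μ times itself. Divided by μ it is idempotent with trace `n` times
  -- `f 0 / μ`. The norm identity is the diagonal case and serves to compute μ.
  multiplicity : ∀ η f → (∀ i → i ≤ D → Δ f i ≡ η * f i) →
    ∃[ μ ] (∑ (λ z → f (dist x₀ z) * f (dist x₀ z)) ≡ μ * f 0) × (μ ≢ 0ℚ → ∃[ N ] ℕtoℚ N * μ ≡ ℕtoℚ n * f 0)
  multiplicity η f Δf≡ηf = μ , trans (product x₀ x₀) (cong (λ d → μ * f d) (dist-refl x₀)) , integral
    where
    open ≡-Reasoning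
    μ = proj₁ (kernel-scalar η f)
    product : ∀ x y → ∑ (λ z → f (dist x z) * f (dist y z)) ≡ μ * f (dist y x)
    product x y = proj₂ (kernel-scalar η f) (λ z → f (dist y z)) (λ z → trans (laplace-radial y f z) (Δf≡ηf (dist y z) (dist≤D y z))) x
    integral : μ ≢ 0ℚ → ∃[ N ] ℕtoℚ N * μ ≡ ℕtoℚ n * f 0
    integral μ≢0 = scaled (recip μ≢0)
      where
      scaled : ∃[ r ] μ * r ≡ 1ℚ → ∃[ N ] ℕtoℚ N * μ ≡ ℕtoℚ n * f 0
      scaled (r , μr≡1) = N , (begin
        ℕtoℚ N * μ                          ≡⟨ cong (_* μ) tr ⟨
        ∑ (λ x → r * f (dist x x)) * μ      ≡⟨ cong (_* μ) (∑-cong λ x → trans (cong (λ d → r * f d) (dist-refl x)) (sym (*-identityʳ (r * f 0)))) ⟩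
        ∑ {n} (λ _ → r * f 0 * 1ℚ) * μ      ≡⟨ cong (_* μ) (trans (∑-*ˡ {n} (r * f 0) (λ _ → 1ℚ)) (cong (r * f 0 *_) (∑-1 n))) ⟩
        r * f 0 * ℕtoℚ n * μ                ≡⟨ solve 4 (λ r p v μ → r :* p :* v :* μ := (μ :* r) :* (v :* p)) refl r (f 0) (ℕtoℚ n) μ ⟩
        (μ * r) * (ℕtoℚ n * f 0)            ≡⟨ cong (_* (ℕtoℚ n * f 0)) μr≡1 ⟩
        1ℚ * (ℕtoℚ n * f 0)                 ≡⟨ *-identityˡ _ ⟩
        ℕtoℚ n * f 0                        ∎)
        where
        E : Matrix n
        E x y = r * f (dist x y)
        idem : Idempotent E
        idem x y = begin
          ∑ (λ z → E x z * E z y)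
            ≡⟨ ∑-cong (λ z → trans (solve 3 (λ r p q → (r :* p) :* (r :* q) := (r :* r) :* (p :* q)) refl r (f (dist x z)) (f (dist z y)))
                                   (cong (λ d → r * r * (f (dist x z) * f d)) (dist-sym z y))) ⟩
          ∑ (λ z → r * r * (f (dist x z) * f (dist y z)))  ≡⟨ ∑-*ˡ (r * r) _ ⟩
          r * r * ∑ (λ z → f (dist x z) * f (dist y z))    ≡⟨ cong (r * r *_) (product x y) ⟩
          r * r * (μ * f (dist y x))
            ≡⟨ solve 3 (λ r μ p → r :* r :* (μ :* p) := (μ :* r) :* (r :* p)) refl r μ (f (dist y x)) ⟩
          (μ * r) * (r * f (dist y x))                     ≡⟨ cong₂ (λ s d → s * (r * f d)) μr≡1 (dist-sym y x) ⟩
          1ℚ * (r * f (dist x y))                          ≡⟨ *-identityˡ _ ⟩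
          r * f (dist x y)                                 ∎
        N = proj₁ (trace-idempotent E idem)
        tr = proj₂ (trace-idempotent E idem)

-- Polynomial identities for b = 2 and α = 9

bracket : ∀ i → [ i ] ℕtoℚ 2 ≡ ℕtoℚ (2 ^ i) - 1ℚ
bracket zero    = refl
bracket (suc i) = begin
  1ℚ + ℕtoℚ 2 * ([ i ] ℕtoℚ 2)        ≡⟨ cong (λ t → 1ℚ + ℕtoℚ 2 * t) (bracket i) ⟩
  1ℚ + ℕtoℚ 2 * (ℕtoℚ (2 ^ i) - 1ℚ)   ≡⟨ solve 1 (λ y → con 1ℚ :+ con (ℕtoℚ 2) :* (y :- con 1ℚ) := con (ℕtoℚ 2) :* y :- con 1ℚ) refl (ℕtoℚ (2 ^ i)) ⟩
  ℕtoℚ 2 * ℕtoℚ (2 ^ i) - 1ℚ          ≡⟨ cong (_- 1ℚ) (ℕtoℚ-* 2 (2 ^ i)) ⟨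
  ℕtoℚ (2 ^ suc i) - 1ℚ               ∎
  where open ≡-Reasoning

-- With w i = 2^{D-i} and W = 2^D one has 2 Δ w = Q - P w, hence P w - Q is an
-- eigenfunction of Δ.
P Q : ℚ → ℚ → ℚ
P β W = W * (β + ℕtoℚ 9) - ℕtoℚ 16
Q β W = W * (ℕtoℚ 9 * W + β - ℕtoℚ 16)

private
  κ : ∀ {m} → ℕ → Polynomial m
  κ k = con (ℕtoℚ k)

  -- Here `y` is 2^i and the two products are 2 c_i and b_i. Their terms `9 y²` cancel, so what
  -- remains has degree at most 1 in `y`, and `y * w ≡ W` makes it affine in `w`. In `ΔW₂` the
  -- square survives and contributes `9 W²`.
  ΔW₁ : ∀ y w β W → y * w ≡ W →
        w * ((y - 1ℚ) * (ℕtoℚ 9 * y - ℕtoℚ 16)) - w * ((W - y) * (β - ℕtoℚ 9 * (y - 1ℚ))) ≡ Q β W + - P β W * w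
  ΔW₁ y w β _ refl = solve 3 (λ y w β →
    w :* ((y :- κ 1) :* (κ 9 :* y :- κ 16)) :- w :* ((y :* w :- y) :* (β :- κ 9 :* (y :- κ 1)))
    := (y :* w) :* (κ 9 :* (y :* w) :+ β :- κ 16) :+ :- ((y :* w) :* (β :+ κ 9) :- κ 16) :* w) refl y w β

  ΔW₂ : ∀ y w β W → y * w ≡ W →
        ℕtoℚ 2 * (w * w * ((y - 1ℚ) * (ℕtoℚ 9 * y - ℕtoℚ 16))) - w * w * ((W - y) * (β - ℕtoℚ 9 * (y - 1ℚ)))
        ≡ ℕtoℚ 9 * (W * W) + (Q β W - ℕtoℚ 25 * W) * w + (ℕtoℚ 16 - P β W) * (w * w)
  ΔW₂ y w β _ refl = solve 3 (λ y w β →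
    κ 2 :* (w :* w :* ((y :- κ 1) :* (κ 9 :* y :- κ 16))) :- w :* w :* ((y :* w :- y) :* (β :- κ 9 :* (y :- κ 1)))
    := κ 9 :* ((y :* w) :* (y :* w)) :+ ((y :* w) :* (κ 9 :* (y :* w) :+ β :- κ 16) :- κ 25 :* (y :* w)) :* w
       :+ (κ 16 :- ((y :* w) :* (β :+ κ 9) :- κ 16)) :* (w :* w)) refl y w β

  -- u₁ and u₂ are the sums of w and w² over all v vertices; the first factor is
  -- the sum of (P w - Q)².
  norm-moment : ∀ P Q W v u₁ u₂ → Q * v + - P * u₁ + 0ℚ * u₂ ≡ 0ℚ →
    ℕtoℚ 9 * (W * W) * v + (Q - ℕtoℚ 25 * W) * u₁ + (ℕtoℚ 16 - P) * u₂ ≡ 0ℚ →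
    (Q * Q * v + - (ℕtoℚ 2 * P * Q) * u₁ + P * P * u₂) * (P - ℕtoℚ 16) ≡ v * (ℕtoℚ 9 * W * P - ℕtoℚ 16 * Q) * (P * W - Q)
  norm-moment P Q W v u₁ u₂ r₁ r₂ = begin
    (Q * Q * v + - (ℕtoℚ 2 * P * Q) * u₁ + P * P * u₂) * (P - ℕtoℚ 16)
      -- The factor `P - 16` is the negated coefficient of `u₂` in the second relation, so `- P²`
      -- times that relation eliminates `u₂`; the multiple `- K` of the first then eliminates `u₁`.
      ≡⟨ solve 6 (λ P Q W v u₁ u₂ →
           (Q :* Q :* v :+ :- (κ 2 :* P :* Q) :* u₁ :+ P :* P :* u₂) :* (P :- κ 16)
           := v :* (κ 9 :* W :* P :- κ 16 :* Q) :* (P :* W :- Q)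
              :+ :- (P :* P) :* (κ 9 :* (W :* W) :* v :+ (Q :- κ 25 :* W) :* u₁ :+ (κ 16 :- P) :* u₂)
              :+ :- (P :* (Q :- κ 25 :* W) :- κ 2 :* (P :- κ 16) :* Q) :* (Q :* v :+ :- P :* u₁ :+ κ 0 :* u₂)) refl P Q W v u₁ u₂ ⟩
    τ + - (P * P) * R₂ + - K * R₁
      ≡⟨ cong₂ (λ s t → τ + - (P * P) * s + - K * t) r₂ r₁ ⟩
    τ + - (P * P) * 0ℚ + - K * 0ℚ
      ≡⟨ solve 3 (λ τ p K → τ :+ p :* κ 0 :+ K :* κ 0 := τ) refl τ (- (P * P)) (- K) ⟩
    τ ∎
    where
    open ≡-Reasoning
    τ = v * (ℕtoℚ 9 * W * P - ℕtoℚ 16 * Q) * (P * W - Q)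
    K = P * (Q - ℕtoℚ 25 * W) - ℕtoℚ 2 * (P - ℕtoℚ 16) * Q
    R₁ = Q * v + - P * u₁ + 0ℚ * u₂
    R₂ = ℕtoℚ 9 * (W * W) * v + (Q - ℕtoℚ 25 * W) * u₁ + (ℕtoℚ 16 - P) * u₂

-- The eigenfunction and its multiplicity for α = 9

module AlphaNine
  (Γ : Graph) (D : ℕ) (c b : ℕ → ℕ) (drg : IsDistanceRegular Γ D c b)
  (β : ℚ)
  (c-formula : ∀ i → i ≤ D → ℕtoℚ (c i) ≡ ([ i ] ℕtoℚ 2) * (1ℚ + ℕtoℚ 9 * ([ i ∸ 1 ] ℕtoℚ 2)))
  (b-formula : ∀ i → i ≤ D → ℕtoℚ (b i) ≡ (([ D ] ℕtoℚ 2) - ([ i ] ℕtoℚ 2)) * (β - ℕtoℚ 9 * ([ i ] ℕtoℚ 2)))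
  where

  open Graph Γ using (n)
  open DistanceRegular Γ D c b drg

  W : ℚ
  W = ℕtoℚ (2 ^ D)

  w : ℕ → ℚ
  w i = ℕtoℚ (2 ^ (D ∸ i))

  private
    y : ℕ → ℚ
    y i = ℕtoℚ (2 ^ i)

    yw≡W : ∀ {i} → i ≤ D → y i * w i ≡ W
    yw≡W {i} i≤D = begin
      y i * w i                      ≡⟨ ℕtoℚ-* (2 ^ i) (2 ^ (D ∸ i)) ⟨
      ℕtoℚ (2 ^ i ℕ.* 2 ^ (D ∸ i))   ≡⟨ cong ℕtoℚ (ℕ.^-distribˡ-+-* 2 i (D ∸ i)) ⟨
      ℕtoℚ (2 ^ (i ℕ.+ (D ∸ i)))     ≡⟨ cong (λ k → ℕtoℚ (2 ^ k)) (ℕ.m+[n∸m]≡n i≤D) ⟩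
      W                              ∎
      where open ≡-Reasoning

    w-halves : ∀ {i} → i < D → w i ≡ ℕtoℚ 2 * w (suc i)
    w-halves {i} i<D = trans (cong (λ k → ℕtoℚ (2 ^ k)) (sym (ℕ.suc-pred (D ∸ i) {{ℕ.>-nonZero (ℕ.m<n⇒0<n∸m i<D)}})))
      (trans (ℕtoℚ-* 2 (2 ^ ℕ.pred (D ∸ i))) (cong (λ k → ℕtoℚ 2 * ℕtoℚ (2 ^ k)) (ℕ.pred[m∸n]≡m∸[1+n] D i)))

    2c≡ : ∀ {i} → i ≤ D → ℕtoℚ 2 * ℕtoℚ (c i) ≡ (y i - 1ℚ) * (ℕtoℚ 9 * y i - ℕtoℚ 16)
    2c≡ {zero} i≤D = trans (cong (ℕtoℚ 2 *_) (c-formula 0 i≤D)) refl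
    2c≡ {suc i} i<D = begin
      ℕtoℚ 2 * ℕtoℚ (c (suc i))   ≡⟨ cong (ℕtoℚ 2 *_) (trans (c-formula (suc i) i<D) (cong₂ (λ s t → s * (1ℚ + ℕtoℚ 9 * t)) (bracket (suc i)) (bracket i))) ⟩
      ℕtoℚ 2 * ((y (suc i) - 1ℚ) * (1ℚ + ℕtoℚ 9 * (y i - 1ℚ)))
        ≡⟨ solve 2 (λ z y → κ 2 :* ((z :- κ 1) :* (κ 1 :+ κ 9 :* (y :- κ 1))) := (z :- κ 1) :* (κ 9 :* (κ 2 :* y) :- κ 16)) refl (y (suc i)) (y i) ⟩
      (y (suc i) - 1ℚ) * (ℕtoℚ 9 * (ℕtoℚ 2 * y i) - ℕtoℚ 16)
        ≡⟨ cong (λ t → (y (suc i) - 1ℚ) * (ℕtoℚ 9 * t - ℕtoℚ 16)) (ℕtoℚ-* 2 (2 ^ i)) ⟨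
      (y (suc i) - 1ℚ) * (ℕtoℚ 9 * y (suc i) - ℕtoℚ 16) ∎
      where open ≡-Reasoning

    b≡ : ∀ {i} → i ≤ D → ℕtoℚ (b i) ≡ (W - y i) * (β - ℕtoℚ 9 * (y i - 1ℚ))
    b≡ {i} i≤D = trans (b-formula i i≤D) (trans
      (cong₂ (λ s t → (s - t) * (β - ℕtoℚ 9 * t)) (bracket D) (bracket i))
      (solve 3 (λ W y β → (W :- κ 1 :- (y :- κ 1)) :* (β :- κ 9 :* (y :- κ 1)) := (W :- y) :* (β :- κ 9 :* (y :- κ 1))) refl W (y i) β))

    -- Truncated subtraction breaks the halving of `w` at both ends of the range: `w (0 ∸ 1)` is
    -- `w 0`, and `w (suc D)` is `w D`. There the coefficients `c 0` and `b D` vanish instead.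
    c-side : ∀ {i} → i ≤ D → w (i ∸ 1) ≡ ℕtoℚ 2 * w i ⊎ ℕtoℚ (c i) ≡ 0ℚ
    c-side {zero}  i≤D = inj₂ (c-formula 0 i≤D)
    c-side {suc i} i<D = inj₁ (w-halves i<D)

    b-side : ∀ {i} → i ≤ D → w i ≡ ℕtoℚ 2 * w (suc i) ⊎ ℕtoℚ (b i) ≡ 0ℚ
    b-side {i} i≤D with i ℕ.≟ D
    ... | no i≢D   = inj₁ (w-halves (ℕ.≤∧≢⇒< i≤D i≢D))
    ... | yes refl = inj₂ (trans (b≡ i≤D) (solve 2 (λ p q → (p :- p) :* q := κ 0) refl W _))

  -- A step inwards changes `w` by `w`, a step outwards by `- w / 2`, which gives half of 2 c_i w -
  -- b_i w.
  Δw : ∀ i → i ≤ D → Δ w i ≡ ½ * (Q β W + - P β W * w i)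
  Δw i i≤D = begin
    (w (i ∸ 1) - w i) * C + (w (suc i) - w i) * B ≡⟨ cong₂ _+_ (up (c-side i≤D)) (down (b-side i≤D)) ⟩
    w i * C + - (½ * w i) * B
      ≡⟨ solve 3 (λ w C B → w :* C :+ :- (con ½ :* w) :* B := con ½ :* (w :* (κ 2 :* C) :- w :* B)) refl (w i) C B ⟩
    ½ * (w i * (ℕtoℚ 2 * C) - w i * B) ≡⟨ cong₂ (λ s t → ½ * (w i * s - w i * t)) (2c≡ i≤D) (b≡ i≤D) ⟩
    _ ≡⟨ cong (½ *_) (ΔW₁ (y i) (w i) β W (yw≡W i≤D)) ⟩
    ½ * (Q β W + - P β W * w i) ∎
    where
    open ≡-Reasoning
    C = ℕtoℚ (c i)
    B = ℕtoℚ (b i)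
    up : w (i ∸ 1) ≡ ℕtoℚ 2 * w i ⊎ C ≡ 0ℚ → (w (i ∸ 1) - w i) * C ≡ w i * C
    up (inj₁ eq) = trans (cong (λ t → (t - w i) * C) eq) (solve 2 (λ w C → (κ 2 :* w :- w) :* C := w :* C) refl (w i) C)
    up (inj₂ eq) = trans (cong ((w (i ∸ 1) - w i) *_) eq) (trans (solve 2 (λ p q → p :* κ 0 := q :* κ 0) refl (w (i ∸ 1) - w i) (w i)) (cong (w i *_) (sym eq)))
    down : w i ≡ ℕtoℚ 2 * w (suc i) ⊎ B ≡ 0ℚ → (w (suc i) - w i) * B ≡ - (½ * w i) * B
    down (inj₁ eq) = trans (cong (λ t → (w (suc i) - t) * B) eq) (trans
      (solve 2 (λ w B → (w :- κ 2 :* w) :* B := :- (con ½ :* (κ 2 :* w)) :* B) refl (w (suc i)) B) (cong (λ t → - (½ * t) * B) (sym eq)))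
    down (inj₂ eq) = trans (cong ((w (suc i) - w i) *_) eq) (trans (solve 2 (λ p q → p :* κ 0 := q :* κ 0) refl (w (suc i) - w i) (- (½ * w i))) (cong (- (½ * w i) *_) (sym eq)))

  quadratic : ℚ → ℚ → ℚ → ℕ → ℚ
  quadratic p q r i = p * 1ℚ + q * w i + r * (w i * w i)

  -- The corresponding changes of `w²` are `3 w²` and `- (3/4) w²`, hence the prefactor 3/4.
  Δw² : ∀ i → i ≤ D → Δ (λ j → w j * w j) i ≡
        ℕtoℚ 3 * (½ * ½) * quadratic (ℕtoℚ 9 * (W * W)) (Q β W - ℕtoℚ 25 * W) (ℕtoℚ 16 - P β W) i
  Δw² i i≤D = begin
    (w (i ∸ 1) * w (i ∸ 1) - w i * w i) * C + (w (suc i) * w (suc i) - w i * w i) * B ≡⟨ cong₂ _+_ (up (c-side i≤D)) (down (b-side i≤D)) ⟩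
    ℕtoℚ 3 * (w i * w i) * C + - (ℕtoℚ 3 * (½ * ½) * (w i * w i)) * B
      ≡⟨ solve 3 (λ w C B → κ 3 :* (w :* w) :* C :+ :- (κ 3 :* (con ½ :* con ½) :* (w :* w)) :* B
           := κ 3 :* (con ½ :* con ½) :* (κ 2 :* (w :* w :* (κ 2 :* C)) :- w :* w :* B)) refl (w i) C B ⟩
    ℕtoℚ 3 * (½ * ½) * (ℕtoℚ 2 * (w i * w i * (ℕtoℚ 2 * C)) - w i * w i * B)
      ≡⟨ cong₂ (λ s t → ℕtoℚ 3 * (½ * ½) * (ℕtoℚ 2 * (w i * w i * s) - w i * w i * t)) (2c≡ i≤D) (b≡ i≤D) ⟩
    _ ≡⟨ cong (ℕtoℚ 3 * (½ * ½) *_) (trans (ΔW₂ (y i) (w i) β W (yw≡W i≤D))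
           (cong (λ t → t + (Q β W - ℕtoℚ 25 * W) * w i + (ℕtoℚ 16 - P β W) * (w i * w i)) (sym (*-identityʳ (ℕtoℚ 9 * (W * W)))))) ⟩
    _ ∎
    where
    open ≡-Reasoning
    C = ℕtoℚ (c i)
    B = ℕtoℚ (b i)
    p = ℕtoℚ 3 * (w i * w i)
    q = - (ℕtoℚ 3 * (½ * ½) * (w i * w i))
    up : w (i ∸ 1) ≡ ℕtoℚ 2 * w i ⊎ C ≡ 0ℚ → (w (i ∸ 1) * w (i ∸ 1) - w i * w i) * C ≡ p * C
    up (inj₁ eq) = trans (cong (λ t → (t * t - w i * w i) * C) eq) (solve 2 (λ w C → (κ 2 :* w :* (κ 2 :* w) :- w :* w) :* C := κ 3 :* (w :* w) :* C) refl (w i) C)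
    up (inj₂ eq) = trans (cong (d *_) eq) (trans (solve 2 (λ p q → p :* κ 0 := q :* κ 0) refl d p) (cong (p *_) (sym eq)))
      where d = w (i ∸ 1) * w (i ∸ 1) - w i * w i
    down : w i ≡ ℕtoℚ 2 * w (suc i) ⊎ B ≡ 0ℚ → (w (suc i) * w (suc i) - w i * w i) * B ≡ q * B
    down (inj₁ eq) = trans (cong (λ t → (w (suc i) * w (suc i) - t * t) * B) eq) (trans
      (solve 2 (λ w B → (w :* w :- κ 2 :* w :* (κ 2 :* w)) :* B := :- (κ 3 :* (con ½ :* con ½) :* (κ 2 :* w :* (κ 2 :* w))) :* B) refl (w (suc i)) B)
      (cong (λ t → - (ℕtoℚ 3 * (½ * ½) * (t * t)) * B) (sym eq)))
    down (inj₂ eq) = trans (cong (d *_) eq) (trans (solve 2 (λ p q → p :* κ 0 := q :* κ 0) refl d q) (cong (q *_) (sym eq)))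
      where d = w (suc i) * w (suc i) - w i * w i

  private
    v u₁ u₂ : ℚ
    v  = ℕtoℚ n
    u₁ = ∑ (λ z → w (dist x₀ z))
    u₂ = ∑ (λ z → w (dist x₀ z) * w (dist x₀ z))

  ∑-quadratic : ∀ p q r → ∑ (λ z → quadratic p q r (dist x₀ z)) ≡ p * v + q * u₁ + r * u₂
  ∑-quadratic p q r = trans (∑-+-* r _ _) (cong (_+ r * u₂) (trans (∑-+-* q _ _) (cong (_+ q * u₁)
    (trans (∑-*ˡ {n} p (λ _ → 1ℚ)) (cong (p *_) (∑-1 n))))))

  moment₁ : Q β W * v + - P β W * u₁ + 0ℚ * u₂ ≡ 0ℚ
  moment₁ = *-cancelˡ-≢0 {½} (λ ()) (begin
    ½ * (Q β W * v + - P β W * u₁ + 0ℚ * u₂) ≡⟨ cong (½ *_) (∑-quadratic (Q β W) (- P β W) 0ℚ) ⟨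
    ½ * ∑ (λ z → quadratic (Q β W) (- P β W) 0ℚ (dist x₀ z)) ≡⟨ ∑-*ˡ ½ _ ⟨
    ∑ (λ z → ½ * quadratic (Q β W) (- P β W) 0ℚ (dist x₀ z))
      ≡⟨ ∑-cong (λ z → trans (cong (½ *_) (solve 3 (λ Q R w → Q :* κ 1 :+ R :* w :+ κ 0 :* (w :* w) := Q :+ R :* w) refl (Q β W) (- P β W) (w (dist x₀ z))))
           (sym (Δw (dist x₀ z) (dist≤D x₀ z)))) ⟩
    ∑ (λ z → Δ w (dist x₀ z)) ≡⟨ ∑-Δ x₀ w ⟩
    0ℚ ≡⟨ *-zeroʳ ½ ⟨
    ½ * 0ℚ ∎)
    where open ≡-Reasoning

  moment₂ : ℕtoℚ 9 * (W * W) * v + (Q β W - ℕtoℚ 25 * W) * u₁ + (ℕtoℚ 16 - P β W) * u₂ ≡ 0ℚ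
  moment₂ = *-cancelˡ-≢0 {ℕtoℚ 3 * (½ * ½)} (λ ()) (begin
    κ₃ * (ℕtoℚ 9 * (W * W) * v + (Q β W - ℕtoℚ 25 * W) * u₁ + (ℕtoℚ 16 - P β W) * u₂)
      ≡⟨ cong (κ₃ *_) (∑-quadratic (ℕtoℚ 9 * (W * W)) (Q β W - ℕtoℚ 25 * W) (ℕtoℚ 16 - P β W)) ⟨
    κ₃ * ∑ (λ z → quadratic (ℕtoℚ 9 * (W * W)) (Q β W - ℕtoℚ 25 * W) (ℕtoℚ 16 - P β W) (dist x₀ z)) ≡⟨ ∑-*ˡ κ₃ _ ⟨
    ∑ (λ z → κ₃ * quadratic (ℕtoℚ 9 * (W * W)) (Q β W - ℕtoℚ 25 * W) (ℕtoℚ 16 - P β W) (dist x₀ z))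
      ≡⟨ ∑-cong (λ z → sym (Δw² (dist x₀ z) (dist≤D x₀ z))) ⟩
    ∑ (λ z → Δ (λ j → w j * w j) (dist x₀ z)) ≡⟨ ∑-Δ x₀ (λ j → w j * w j) ⟩
    0ℚ ≡⟨ *-zeroʳ κ₃ ⟨
    κ₃ * 0ℚ ∎)
    where
    open ≡-Reasoning
    κ₃ = ℕtoℚ 3 * (½ * ½)

  eigenvector : ℕ → ℚ
  eigenvector i = P β W * w i - Q β W

  eigenvector-Δ : ∀ i → i ≤ D → Δ eigenvector i ≡ - (½ * P β W) * eigenvector i
  eigenvector-Δ i i≤D = begin
    Δ eigenvector i
      ≡⟨ solve 7 (λ P Q a d e C B → (P :* a :- Q :- (P :* d :- Q)) :* C :+ (P :* e :- Q :- (P :* d :- Q)) :* B := P :* ((a :- d) :* C :+ (e :- d) :* B))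
           refl (P β W) (Q β W) (w (i ∸ 1)) (w i) (w (suc i)) (ℕtoℚ (c i)) (ℕtoℚ (b i)) ⟩
    P β W * Δ w i ≡⟨ cong (P β W *_) (Δw i i≤D) ⟩
    P β W * (½ * (Q β W + - P β W * w i))
      ≡⟨ solve 3 (λ P Q w → P :* (con ½ :* (Q :+ :- P :* w)) := :- (con ½ :* P) :* (P :* w :- Q)) refl (P β W) (Q β W) (w i) ⟩
    - (½ * P β W) * eigenvector i ∎
    where open ≡-Reasoning

  -- Two relations determine μ: N μ = v f(0) from the trace, and μ (P - 16) = v W τ from the norm.
  -- Eliminating μ and cancelling `v * W` leaves the claim, since f(0) = P W - Q = W (W - 1) β.
  multiplicity-equation : W ≢ 0ℚ → W - 1ℚ ≢ 0ℚ → β ≢ 0ℚ → (ℕtoℚ 9 * W - ℕtoℚ 16) * (β - ℕtoℚ 7) ≢ 0ℚ →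
    ∃[ N ] ℕtoℚ N * ((ℕtoℚ 9 * W - ℕtoℚ 16) * (β - ℕtoℚ 7)) ≡ (W - 1ℚ) * β * (W * (β + ℕtoℚ 9) - ℕtoℚ 32)
  multiplicity-equation W≢0 W≢1 β≢0 τ≢0 = N , *-cancelˡ-≢0 (*-≢0 v≢0 W≢0) (begin
    v * W * (ℕtoℚ N * τ)                        ≡⟨ solve 4 (λ v W N τ → v :* W :* (N :* τ) := N :* (v :* (W :* τ))) refl v W (ℕtoℚ N) τ ⟩
    ℕtoℚ N * (v * (W * τ))                      ≡⟨ cong (ℕtoℚ N *_) μ-equation ⟨
    ℕtoℚ N * (μ * (P β W - ℕtoℚ 16))            ≡⟨ *-assoc (ℕtoℚ N) μ _ ⟨
    ℕtoℚ N * μ * (P β W - ℕtoℚ 16)              ≡⟨ cong (_* (P β W - ℕtoℚ 16)) Nμ≡ ⟩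
    v * eigenvector 0 * (P β W - ℕtoℚ 16)       ≡⟨ cong (λ t → v * t * (P β W - ℕtoℚ 16)) f₀≡ ⟩
    v * (W * ((W - 1ℚ) * β)) * (P β W - ℕtoℚ 16)
      ≡⟨ solve 3 (λ v W β → v :* (W :* ((W :- κ 1) :* β)) :* (W :* (β :+ κ 9) :- κ 16 :- κ 16)
           := v :* W :* ((W :- κ 1) :* β :* (W :* (β :+ κ 9) :- κ 32))) refl v W β ⟩
    v * W * ((W - 1ℚ) * β * (W * (β + ℕtoℚ 9) - ℕtoℚ 32)) ∎)
    where
    open ≡-Reasoning
    τ = (ℕtoℚ 9 * W - ℕtoℚ 16) * (β - ℕtoℚ 7)
    v≢0 : v ≢ 0ℚ
    v≢0 = ℕtoℚ-≢0 (ℕ.≤-<-trans z≤n (toℕ<n x₀))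
    f₀≡ : eigenvector 0 ≡ W * ((W - 1ℚ) * β)
    f₀≡ = solve 2 (λ W β → (W :* (β :+ κ 9) :- κ 16) :* W :- W :* (κ 9 :* W :+ β :- κ 16) := W :* ((W :- κ 1) :* β)) refl W β
    f₀≢0 : eigenvector 0 ≢ 0ℚ
    f₀≢0 = subst (_≢ 0ℚ) (sym f₀≡) (*-≢0 W≢0 (*-≢0 W≢1 β≢0))
    m = multiplicity (- (½ * P β W)) eigenvector eigenvector-Δ
    μ = proj₁ m
    norm≡ : ∑ (λ z → eigenvector (dist x₀ z) * eigenvector (dist x₀ z)) ≡ μ * eigenvector 0
    norm≡ = proj₁ (proj₂ m)
    μ-equation : μ * (P β W - ℕtoℚ 16) ≡ v * (W * τ)
    μ-equation = *-cancelˡ-≢0 f₀≢0 (begin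
      eigenvector 0 * (μ * (P β W - ℕtoℚ 16))
        ≡⟨ solve 3 (λ f μ p → f :* (μ :* p) := μ :* f :* p) refl (eigenvector 0) μ (P β W - ℕtoℚ 16) ⟩
      μ * eigenvector 0 * (P β W - ℕtoℚ 16)
        ≡⟨ cong (_* (P β W - ℕtoℚ 16)) (begin
             μ * eigenvector 0 ≡⟨ norm≡ ⟨
             ∑ (λ z → eigenvector (dist x₀ z) * eigenvector (dist x₀ z))
               ≡⟨ ∑-cong (λ z → solve 3 (λ P Q w → (P :* w :- Q) :* (P :* w :- Q) := Q :* Q :* κ 1 :+ :- (κ 2 :* P :* Q) :* w :+ P :* P :* (w :* w))
                    refl (P β W) (Q β W) (w (dist x₀ z))) ⟩
             ∑ (λ z → quadratic (Q β W * Q β W) (- (ℕtoℚ 2 * P β W * Q β W)) (P β W * P β W) (dist x₀ z))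
               ≡⟨ ∑-quadratic (Q β W * Q β W) (- (ℕtoℚ 2 * P β W * Q β W)) (P β W * P β W) ⟩
             Q β W * Q β W * v + - (ℕtoℚ 2 * P β W * Q β W) * u₁ + P β W * P β W * u₂ ∎) ⟩
      (Q β W * Q β W * v + - (ℕtoℚ 2 * P β W * Q β W) * u₁ + P β W * P β W * u₂) * (P β W - ℕtoℚ 16)
        ≡⟨ norm-moment (P β W) (Q β W) W v u₁ u₂ moment₁ moment₂ ⟩
      v * (ℕtoℚ 9 * W * P β W - ℕtoℚ 16 * Q β W) * eigenvector 0
        ≡⟨ solve 4 (λ v W β f → v :* (κ 9 :* W :* (W :* (β :+ κ 9) :- κ 16) :- κ 16 :* (W :* (κ 9 :* W :+ β :- κ 16))) :* f
             := f :* (v :* (W :* ((κ 9 :* W :- κ 16) :* (β :- κ 7))))) refl v W β (eigenvector 0) ⟩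
      eigenvector 0 * (v * (W * τ)) ∎)
    μ≢0 : μ ≢ 0ℚ
    μ≢0 μ≡0 = *-≢0 v≢0 (*-≢0 W≢0 τ≢0) (trans (sym μ-equation) (trans (cong (_* (P β W - ℕtoℚ 16)) μ≡0) (*-zeroˡ (P β W - ℕtoℚ 16))))
    N = proj₁ (proj₂ (proj₂ m) μ≢0)
    Nμ≡ : ℕtoℚ N * μ ≡ v * eigenvector 0
    Nμ≡ = proj₂ (proj₂ (proj₂ m) μ≢0)

-- Classical parameters with b = 2: the values of α

module Classical
  (Γ : Graph) (D : ℕ) (c b : ℕ → ℕ) (drg : IsDistanceRegular Γ D c b)
  (α β : ℚ)
  (c-formula : ∀ i → i ≤ D → ℕtoℚ (c i) ≡ ([ i ] ℕtoℚ 2) * (1ℚ + α * ([ i ∸ 1 ] ℕtoℚ 2)))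
  (b-formula : ∀ i → i ≤ D → ℕtoℚ (b i) ≡ (([ D ] ℕtoℚ 2) - ([ i ] ℕtoℚ 2)) * (β - α * ([ i ] ℕtoℚ 2)))
  (12≤D : 12 ≤ D)
  where

  open DistanceRegular Γ D c b drg

  -- The formula c_2 = 3 + 3α makes 3α an integer. It is nonnegative because 7 c_2 = c_3 + 14 with
  -- c_3 positive, whence c_2 ≥ 3.
  3α-natural : ∃[ s ] ℕtoℚ 3 * α ≡ ℕtoℚ s
  3α-natural = c 2 ∸ 3 , (begin
    ℕtoℚ 3 * α                      ≡⟨ solve 1 (λ a → con (ℕtoℚ 3) :* a := con (ℕtoℚ 3) :* (con 1ℚ :+ a :* con 1ℚ) :- con (ℕtoℚ 3)) refl α ⟩
    ℕtoℚ 3 * (1ℚ + α * 1ℚ) - ℕtoℚ 3 ≡⟨ cong (_- ℕtoℚ 3) (c-formula 2 2≤D) ⟨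
    ℕtoℚ (c 2) - ℕtoℚ 3             ≡⟨ cong (λ k → ℕtoℚ k - ℕtoℚ 3) (ℕ.m∸n+n≡m 3≤c₂) ⟨
    ℕtoℚ (c 2 ∸ 3 ℕ.+ 3) - ℕtoℚ 3   ≡⟨ cong (_- ℕtoℚ 3) (ℕtoℚ-+ (c 2 ∸ 3) 3) ⟩
    ℕtoℚ (c 2 ∸ 3) + ℕtoℚ 3 - ℕtoℚ 3 ≡⟨ solve 1 (λ a → a :+ con (ℕtoℚ 3) :- con (ℕtoℚ 3) := a) refl (ℕtoℚ (c 2 ∸ 3)) ⟩
    ℕtoℚ (c 2 ∸ 3)                  ∎)
    where
    open ≡-Reasoning
    2≤D : 2 ≤ D
    2≤D = ℕ.≤-trans (toWitness {a? = 2 ≤? 12} _) 12≤D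
    3≤D : 3 ≤ D
    3≤D = ℕ.≤-trans (toWitness {a? = 3 ≤? 12} _) 12≤D
    c₃≡ : c 3 ℕ.+ 14 ≡ 7 ℕ.* c 2
    c₃≡ = ℕtoℚ-injective (begin
      ℕtoℚ (c 3 ℕ.+ 14)          ≡⟨ trans (ℕtoℚ-+ (c 3) 14) (cong (_+ ℕtoℚ 14) (c-formula 3 3≤D)) ⟩
      ℕtoℚ 7 * (1ℚ + α * ℕtoℚ 3) + ℕtoℚ 14
        ≡⟨ solve 1 (λ a → con (ℕtoℚ 7) :* (con 1ℚ :+ a :* con (ℕtoℚ 3)) :+ con (ℕtoℚ 14) := con (ℕtoℚ 7) :* (con (ℕtoℚ 3) :* (con 1ℚ :+ a :* con 1ℚ))) refl α ⟩
      ℕtoℚ 7 * (ℕtoℚ 3 * (1ℚ + α * 1ℚ)) ≡⟨ trans (ℕtoℚ-* 7 (c 2)) (cong (ℕtoℚ 7 *_) (c-formula 2 2≤D)) ⟨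
      ℕtoℚ (7 ℕ.* c 2)           ∎)
    3≤c₂ : 3 ≤ c 2
    3≤c₂ = ℕ.*-cancelˡ-< 7 2 (c 2) (subst (14 <_) c₃≡ (ℕ.+-monoˡ-< 14 (c-positive 3≤D)))

  3c≡tripleC : ∀ s → ℕtoℚ 3 * α ≡ ℕtoℚ s → ∀ i → i < D → 3 ℕ.* c (suc i) ≡ tripleC s i
  3c≡tripleC s 3α≡s i i<D = ℕtoℚ-injective (begin
    ℕtoℚ (3 ℕ.* c (suc i)) ≡⟨ trans (ℕtoℚ-* 3 (c (suc i))) (cong (ℕtoℚ 3 *_) (c-formula (suc i) i<D)) ⟩
    ℕtoℚ 3 * (g′ * (1ℚ + α * g)) ≡⟨ solve 3 (λ a g g′ → con (ℕtoℚ 3) :* (g′ :* (con 1ℚ :+ a :* g)) := g′ :* (con (ℕtoℚ 3) :+ con (ℕtoℚ 3) :* a :* g)) refl α g g′ ⟩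
    g′ * (ℕtoℚ 3 + ℕtoℚ 3 * α * g) ≡⟨ cong (λ t → g′ * (ℕtoℚ 3 + t * g)) 3α≡s ⟩
    g′ * (ℕtoℚ 3 + ℕtoℚ s * g) ≡⟨ cong₂ (λ p q → p * (ℕtoℚ 3 + ℕtoℚ s * q)) (ℕtoℚ-bracketℕ (suc i)) (ℕtoℚ-bracketℕ i) ⟨
    ℕtoℚ (bracketℕ (suc i)) * (ℕtoℚ 3 + ℕtoℚ s * ℕtoℚ (bracketℕ i))
      ≡⟨ trans (ℕtoℚ-* (bracketℕ (suc i)) (3 ℕ.+ s ℕ.* bracketℕ i)) (cong (ℕtoℚ (bracketℕ (suc i)) *_)
           (trans (ℕtoℚ-+ 3 (s ℕ.* bracketℕ i)) (cong (λ t → ℕtoℚ 3 + t) (ℕtoℚ-* s (bracketℕ i))))) ⟨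
    ℕtoℚ (tripleC s i) ∎)
    where
    open ≡-Reasoning
    g g′ : ℚ
    g  = [ i ] ℕtoℚ 2
    g′ = [ suc i ] ℕtoℚ 2

  factorial-tripleC : ∀ s → ℕtoℚ 3 * α ≡ ℕtoℚ s → ∀ k → k ≤ D → factorial (tripleC s) k ≡ 3 ^ k ℕ.* factorial (c ∘ suc) k
  factorial-tripleC s 3α≡s k k≤D = trans (factorial-cong k (λ i i<k → sym (3c≡tripleC s 3α≡s i (ℕ.<-≤-trans i<k k≤D))))
    (factorial-scale (c ∘ suc) 3 k)

  -- Passing from `c` to `3 c` multiplies both sides of the geodesic divisibility by the same power
  -- 3^{2j}.
  central : ∀ s → ℕtoℚ 3 * α ≡ ℕtoℚ s → ∀ j → j ℕ.+ j ≤ D → CentralDivides s j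
  central s 3α≡s j 2j≤D = subst₂ _∣_
    (sym (trans (cong₂ ℕ._*_ scaled scaled) (ℕ.[m*n]*[o*p]≡[m*o]*[n*p] (3 ^ j) (factorial (c ∘ suc) j) (3 ^ j) (factorial (c ∘ suc) j))))
    (sym (trans (factorial-tripleC s 3α≡s (j ℕ.+ j) 2j≤D) (cong (ℕ._* factorial (c ∘ suc) (j ℕ.+ j)) (ℕ.^-distribˡ-+-* 3 j j))))
    (*-monoʳ-∣ (3 ^ j ℕ.* 3 ^ j) (c!-∣ j j 2j≤D))
    where
    scaled = factorial-tripleC s 3α≡s j (ℕ.m+n≤o⇒m≤o j 2j≤D)

  module _ (α≡9 : α ≡ ℕtoℚ 9) where

    private
      D<14 : D < 14
      D<14 = ℕ.≰⇒> λ 14≤D → ¬centralDivides-27-7 (central 27 (cong (ℕtoℚ 3 *_) α≡9) 7 14≤D)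

      c₉ : ∀ i → i ≤ D → ℕtoℚ (c i) ≡ ([ i ] ℕtoℚ 2) * (1ℚ + ℕtoℚ 9 * ([ i ∸ 1 ] ℕtoℚ 2))
      c₉ i i≤D = subst (λ a → ℕtoℚ (c i) ≡ ([ i ] ℕtoℚ 2) * (1ℚ + a * ([ i ∸ 1 ] ℕtoℚ 2))) α≡9 (c-formula i i≤D)

      b₉ : ∀ i → i ≤ D → ℕtoℚ (b i) ≡ (([ D ] ℕtoℚ 2) - ([ i ] ℕtoℚ 2)) * (β - ℕtoℚ 9 * ([ i ] ℕtoℚ 2))
      b₉ i i≤D = subst (λ a → ℕtoℚ (b i) ≡ (([ D ] ℕtoℚ 2) - ([ i ] ℕtoℚ 2)) * (β - a * ([ i ] ℕtoℚ 2))) α≡9 (b-formula i i≤D)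

    open AlphaNine Γ D c b drg β c₉ b₉ using (multiplicity-equation)

    private
      -- The strict lower bound for β is written `6 + A`, so that `d = g + A` equals β - 7 and is at
      -- least `A`. The coefficients other than `R` enter as successors, which makes the
      -- nonvanishing conditions immediate.
      equation-for-d : ∀ K M L R A {g} → β ≡ ℕtoℚ (suc g ℕ.+ (6 ℕ.+ A)) →
        ℕtoℚ 9 * ℕtoℚ (2 ^ D) - ℕtoℚ 16 ≡ ℕtoℚ 16 * ℕtoℚ (suc K) → ℕtoℚ (2 ^ D) - 1ℚ ≡ ℕtoℚ (suc M) →
        ℕtoℚ (2 ^ D) ≡ ℕtoℚ 16 * ℕtoℚ (suc L) → ℕtoℚ (2 ^ D) * ℕtoℚ 16 - ℕtoℚ 32 ≡ ℕtoℚ 16 * ℕtoℚ R → 0 < A →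
        ∃[ N ] Equation (suc K) (suc M) (suc L) R N (g ℕ.+ A)
      equation-for-d K M L R A {g} hβ hK hM hL hR 0<A = proj₁ m , multiplicity⇒Equation (suc K) (suc M) (suc L) R hK hM hL hR β≡d+7 (proj₂ m)
        where
        d = g ℕ.+ A
        β≡d+7 : β ≡ ℕtoℚ (d ℕ.+ 7)
        β≡d+7 = trans hβ (cong ℕtoℚ (S.solve 2 (λ g A → S.con 1 S.:+ g S.:+ (S.con 6 S.:+ A) S.:= g S.:+ A S.:+ S.con 7) refl g A))
        β-7≡d : β - ℕtoℚ 7 ≡ ℕtoℚ d
        β-7≡d = trans (cong (_- ℕtoℚ 7) (trans β≡d+7 (ℕtoℚ-+ d 7))) (solve 1 (λ d → d :+ con (ℕtoℚ 7) :- con (ℕtoℚ 7) := d) refl (ℕtoℚ d))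
        positive : ∀ k → ℕtoℚ (suc k) ≢ 0ℚ
        positive k = ℕtoℚ-≢0 {suc k} (s≤s z≤n)
        m = multiplicity-equation
          (subst (_≢ 0ℚ) (sym hL) (*-≢0 {ℕtoℚ 16} (λ ()) (positive L)))
          (subst (_≢ 0ℚ) (sym hM) (positive M))
          (subst (_≢ 0ℚ) (sym hβ) (positive (g ℕ.+ (6 ℕ.+ A))))
          (*-≢0 (subst (_≢ 0ℚ) (sym hK) (*-≢0 {ℕtoℚ 16} (λ ()) (positive K))) (subst (_≢ 0ℚ) (sym β-7≡d) (ℕtoℚ-≢0 {d} (ℕ.<-≤-trans 0<A (ℕ.m≤n+m A g)))))

      bNumeral : ℕ → ℕ
      bNumeral i = (4096 ∸ 2 ^ i) ℕ.* (128968 ∸ 9 ℕ.* bracketℕ i)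

      ¬survivor : D ≡ 12 → β ≢ ℕtoℚ 128968
      -- The sphere of radius 7 has b_0⋯b_6 / (c_1⋯c_7) vertices; numerator and denominator are
      -- scaled by 3^7 in order to use `tripleC 27`.
      ¬survivor refl β≡ = toWitnessFalse {a? = factorial (tripleC 27) 7 ∣? 3 ^ 7 ℕ.* factorial bNumeral 7} _
        (subst₂ _∣_ (sym (factorial-tripleC 27 (cong (ℕtoℚ 3 *_) α≡9) 7 (toWitness {a? = 7 ≤? 12} _)))
          (cong (3 ^ 7 ℕ.*_) (factorial-cong {b} {bNumeral} 7 b≡bNumeral))
          (*-monoʳ-∣ (3 ^ 7) (c!-∣-b! 7)))
        where
        numeral : ∀ {i} → i < 7 → (([ 12 ] ℕtoℚ 2) - ([ i ] ℕtoℚ 2)) * (ℕtoℚ 128968 - ℕtoℚ 9 * ([ i ] ℕtoℚ 2)) ≡ ℕtoℚ (bNumeral i)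
        numeral = toWitness {a? = ℕ.allUpTo? (λ i → (([ 12 ] ℕtoℚ 2) - ([ i ] ℕtoℚ 2)) * (ℕtoℚ 128968 - ℕtoℚ 9 * ([ i ] ℕtoℚ 2)) ℚ.≟ ℕtoℚ (bNumeral i)) 7} _
        b≡bNumeral : ∀ i → i < 7 → b i ≡ bNumeral i
        b≡bNumeral i i<7 = ℕtoℚ-injective {b i} {bNumeral i} (trans (b₉ i (ℕ.≤-trans (ℕ.<⇒≤ i<7) (toWitness {a? = 7 ≤? 12} _)))
          (trans (cong (λ t → (([ 12 ] ℕtoℚ 2) - ([ i ] ℕtoℚ 2)) * (t - ℕtoℚ 9 * ([ i ] ℕtoℚ 2))) β≡) (numeral i<7)))

      exclude-12 : D ≢ 12
      -- b_0 = 4095 β and b_11 = (4095 - 2047)(β - 9 · 2047), where 9 · 2047 = 18423 = 6 + 18417.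
      exclude-12 refl = finish (β-natural 4095 2048 18423 {b 0} {b 11} β refl b₀≡ (b₉ 11 11≤12) (b-positive (ℕ.n<1+n 11)))
        where
        11≤12 : 11 ≤ 12
        11≤12 = ℕ.n≤1+n 11
        b₀≡ : ℕtoℚ (b 0) ≡ ℕtoℚ 4095 * β
        b₀≡ = trans (b₉ 0 z≤n) (solve 1 (λ β → con (ℕtoℚ 4095) :* (β :- con 0ℚ) := con (ℕtoℚ 4095) :* β) refl β)
        finish : ∃[ g ] β ≡ ℕtoℚ (suc g ℕ.+ 18423) → ⊥
        finish (g , β≡) = ¬survivor refl (trans β≡ (cong ℕtoℚ (trans
            (S.solve 1 (λ g → S.con 1 S.:+ g S.:+ S.con 18423 S.:= g S.:+ S.con 18417 S.:+ S.con 7) refl g) (cong (ℕ._+ 7) d≡))))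
          where
          d≡ : g ℕ.+ 18417 ≡ 128961
          d≡ = solutions-12 (proj₂ (equation-for-d 2302 4094 255 4094 18417 β≡ refl refl refl refl (s≤s z≤n))) (ℕ.m≤n+m 18417 g)

      exclude-13 : D ≢ 13
      -- Likewise b_0 = 8191 β and b_12 = 4096 (β - 9 · 4095), where 9 · 4095 = 36855 = 6 + 36849.
      exclude-13 refl = finish (β-natural 8191 4096 36855 {b 0} {b 12} β refl b₀≡ (b₉ 12 12≤13) (b-positive (ℕ.n<1+n 12)))
        where
        12≤13 : 12 ≤ 13
        12≤13 = ℕ.n≤1+n 12
        b₀≡ : ℕtoℚ (b 0) ≡ ℕtoℚ 8191 * β
        b₀≡ = trans (b₉ 0 z≤n) (solve 1 (λ β → con (ℕtoℚ 8191) :* (β :- con 0ℚ) := con (ℕtoℚ 8191) :* β) refl β)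
        finish : ∃[ g ] β ≡ ℕtoℚ (suc g ℕ.+ 36855) → ⊥
        finish (g , β≡) = solutions-13 (proj₂ (equation-for-d 4606 8190 511 8190 36849 β≡ refl refl refl refl (s≤s z≤n))) (ℕ.m≤n+m 36849 g)

    α≢9 : ⊥
    α≢9 with D ≟ 12 | D ≟ 13
    ... | yes D≡12 | _        = exclude-12 D≡12
    ... | no _     | yes D≡13 = exclude-13 D≡13
    ... | no D≢12  | no D≢13  = ℕ.<⇒≱ D<14 (ℕ.≤∧≢⇒< (ℕ.≤∧≢⇒< 12≤D (D≢12 ∘ sym)) (D≢13 ∘ sym))

  Listed : Set
  Listed = α ≡ 0ℚ ⊎ α ≡ (+ 1) / 3 ⊎ α ≡ (+ 2) / 3 ⊎ α ≡ 1ℚ ⊎ α ≡ (+ 4) / 3 ⊎ α ≡ (+ 2) / 1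

  α-list : ∀ s → ℕtoℚ 3 * α ≡ ℕtoℚ s → s ∈ candidates →
    α ≤ℚ (+ 2) / 1 × Listed
  α-list s 3α≡s s∈ = bound alternatives , alternatives
    where
    third : ∀ p k → ℕtoℚ 3 * p ≡ ℕtoℚ k → s ≡ k → α ≡ p
    third p k 3p≡k s≡k = *-cancelˡ-≢0 {ℕtoℚ 3} (λ ()) (trans 3α≡s (trans (cong ℕtoℚ s≡k) (sym 3p≡k)))
    select : s ∈ candidates → Listed
    select (here eq)                                 = inj₁ (third 0ℚ 0 refl eq)
    select (there (here eq))                         = inj₂ (inj₁ (third ((+ 1) / 3) 1 refl eq))
    select (there (there (here eq)))                 = inj₂ (inj₂ (inj₁ (third ((+ 2) / 3) 2 refl eq)))
    select (there (there (there (here eq))))         = inj₂ (inj₂ (inj₂ (inj₁ (third 1ℚ 3 refl eq))))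
    select (there (there (there (there (here eq))))) = inj₂ (inj₂ (inj₂ (inj₂ (inj₁ (third ((+ 4) / 3) 4 refl eq)))))
    select (there (there (there (there (there (here eq)))))) = inj₂ (inj₂ (inj₂ (inj₂ (inj₂ (third ((+ 2) / 1) 6 refl eq)))))
    select (there (there (there (there (there (there (here eq))))))) = ⊥-elim (α≢9 (third (ℕtoℚ 9) 27 refl eq))
    alternatives = select s∈
    bound : Listed → α ≤ℚ (+ 2) / 1
    bound (inj₁ refl)                             = toWitness {a? = 0ℚ ≤ℚ? (+ 2) / 1} _
    bound (inj₂ (inj₁ refl))                      = toWitness {a? = (+ 1) / 3 ≤ℚ? (+ 2) / 1} _
    bound (inj₂ (inj₂ (inj₁ refl)))               = toWitness {a? = (+ 2) / 3 ≤ℚ? (+ 2) / 1} _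
    bound (inj₂ (inj₂ (inj₂ (inj₁ refl))))        = toWitness {a? = 1ℚ ≤ℚ? (+ 2) / 1} _
    bound (inj₂ (inj₂ (inj₂ (inj₂ (inj₁ refl))))) = toWitness {a? = (+ 4) / 3 ≤ℚ? (+ 2) / 1} _
    bound (inj₂ (inj₂ (inj₂ (inj₂ (inj₂ refl))))) = ℚ.≤-refl

  conclusion : α ≤ℚ (+ 2) / 1 × Listed
  conclusion = α-list s 3α≡s (survivors s (λ j j≤6 → central s 3α≡s j (ℕ.≤-trans (ℕ.+-mono-≤ j≤6 j≤6) 12≤D)))
    where
    s = proj₁ 3α-natural
    3α≡s = proj₂ 3α-natural

theorem1p2 : (Γ : Graph) (D : ℕ) (b α β : ℚ) →
    HasClassicalParameters Γ D b α β →
    b ≡ (+ 2) / 1 → 12 ≤ D →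
    (α ≤ℚ (+ 2) / 1) ×
    (α ≡ 0ℚ ⊎ α ≡ (+ 1) / 3 ⊎ α ≡ (+ 2) / 3 ⊎ α ≡ 1ℚ ⊎ α ≡ (+ 4) / 3 ⊎ α ≡ (+ 2) / 1)
theorem1p2 Γ D _ α β (c , b , drg , formulas) refl 12≤D =
  Classical.conclusion Γ D c b drg α β
    (λ i i≤D → proj₁ (formulas i i≤D)) (λ i i≤D → proj₂ (formulas i i≤D)) 12≤D
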